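{- Let $n$ be a positive integer and let $D \geq 3$ be an integer. There exists a graph with order $n$, monophonic position number $2$ and diameter $D$ if and only if $D = n-1$ or $3 \leq D \leq \lfloor \frac{n}{2} \rfloor$.
   Context: All graphs are finite, simple and undirected; the order of a graph is its number of vertices. A graph of (finite) diameter $D$ is understood to be connected. A monophonic path is an induced (chordless) path. A set $S$ of vertices of a graph $G$ is in monophonic position if no monophonic path of $G$ contains more than two elements of $S$; the monophonic position number of $G$ is the largest size of such a set. -}

module Defs where

open import Data.Fin.Base using (Fin; toℕ)
open import Data.Fin.Subset using (Subset; ⁅_⁆; ⋃; _∩_; ∣_∣)
open import Data.List.Base using (List; head; last; length; lookup; map)
open import Data.List.Relation.Unary.Linked using (Linked)
open import Data.List.Relation.Unary.Unique.Propositional using (Unique)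
open import Data.Maybe.Base using (just)
open import Data.Nat.Base using (ℕ; suc; _≤_; _<_)
open import Data.Product.Base using (_×_; ∃; ∃₂)
open import Level using (0ℓ)
open import Relation.Binary.Core using (Rel)
open import Relation.Binary.Definitions using (Decidable; Irreflexive; Symmetric)
open import Relation.Binary.PropositionalEquality.Core using (_≡_)
open import Relation.Nullary.Negation.Core using (¬_)

-- Decidability of adjacency is automatic classically; it is a field so that
-- finite graphs behave constructively as they do classically.
record Graph (n : ℕ) : Set₁ where
  field
    Adj    : Rel (Fin n) 0ℓ
    sym    : Symmetric Adj
    irrefl : Irreflexive _≡_ Adj
    adj?   : Decidable Adj

module _ {n : ℕ} (G : Graph n) where
  open Graph G

  -- A path is given by the list of its vertices, so its length (number of
  -- edges) is one less than that of the list. The endpoint conditions exclude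
  -- the empty list; a single vertex is a path of length 0.
  record IsPath (u v : Fin n) (xs : List (Fin n)) : Set where
    field
      starts : head xs ≡ just u
      ends   : last xs ≡ just v
      linked : Linked Adj xs
      unique : Unique xs

  -- A chord joins two vertices of the path at positions at least 2 apart.
  Chordless : List (Fin n) → Set
  Chordless xs = ∀ (i j : Fin (length xs)) → suc (toℕ i) < toℕ j →
                 ¬ Adj (lookup xs i) (lookup xs j)

  IsMonophonicPath : Fin n → Fin n → List (Fin n) → Set
  IsMonophonicPath u v xs = IsPath u v xs × Chordless xs

  Connected : Set
  Connected = ∀ u v → ∃ λ xs → IsPath u v xs

  HasDistance : Fin n → Fin n → ℕ → Set
  HasDistance u v d = (∃ λ xs → IsPath u v xs × length xs ≡ suc d)
                    × (∀ xs → IsPath u v xs → suc d ≤ length xs)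

  HasDiameter : ℕ → Set
  HasDiameter D = Connected
                × (∃₂ λ u v → HasDistance u v D)
                × (∀ u v d → HasDistance u v d → d ≤ D)

  InMonophonicPosition : Subset n → Set
  InMonophonicPosition S = ∀ u v xs → IsMonophonicPath u v xs →
                           ∣ S ∩ ⋃ (map ⁅_⁆ xs) ∣ ≤ 2

  HasMonophonicPositionNumber : ℕ → Set
  HasMonophonicPositionNumber k =
      (∃ λ S → InMonophonicPosition S × ∣ S ∣ ≡ k)
    × (∀ S → InMonophonicPosition S → ∣ S ∣ ≤ k)

-- Two vertices are always in monophonic position, so the monophonic position
-- number of a graph on at least two vertices is 2 exactly when any three vertices
-- lie on a common induced path.
--
-- Necessity. Layer the vertices by their distance from an end w of a diametral
-- pair u, w. If n < 2D, some layer strictly between w and u is a single vertex c.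
-- Then the next layer is a single vertex as well: two vertices there, together
-- with a neighbour of c in the previous layer, would lie on an induced path, which
-- passes through c and so contains three neighbours of c. Thus all later layers,
-- up to u, are singletons, so u has only one neighbour; layering from u instead,
-- all layers are singletons, and n = D + 1.
--
-- Sufficiency. For D = n - 1 take a path. Otherwise subdivide one edge of a crown
-- graph 2D - 6 or 2D - 5 times, depending on the parity of n. Vertices with at
-- most one matching index outside the ends of the subdivided edge lie on an
-- induced cycle of length 2D or 2D + 1, which gives both the induced paths and
-- the distances; the remaining cases use explicit induced paths.

module Submission where

open import Defs
open import Data.Bool.Base using (true; false)
open import Data.Fin.Base as Fin using (Fin; zero; suc; toℕ; fromℕ; inject₁; fromℕ<)
import Data.Fin.Properties as Fin
open import Data.Fin.Relation.Unary.Top using (view; ‵fromℕ; ‵inject₁)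
open import Data.Fin.Subset using (Subset; ⁅_⁆; ⋃; _∪_; ∣_∣; _∈_; _∉_; _⊆_; ⊥)
open import Data.Fin.Subset.Properties
  using (_∈?_; p⊆q⇒∣p∣≤∣q∣; p⊂q⇒∣p∣<∣q∣; ∣⁅x⁆∣≡1; ∣⊥∣≡0; x∈⁅x⁆; x∈⁅y⁆⇒x≡y; ∉⊥; x∈p∪q⁻; x∈p∪q⁺;
         x∈p∩q⁺; x∈p∩q⁻; ∣p∩q∣≤∣p∣)
open import Data.List.Base
  using (List; []; _∷_; _++_; length; map; head; last; lookup; tabulate)
open import Data.List.Membership.DecPropositional using () renaming (_∈?_ to ∈-dec)
import Data.List.Membership.Propositional as List
open import Data.List.Membership.Propositional.Properties
  using (∈-map⁺; ∈-tabulate⁺; ∈-lookup; ∈-++⁺ˡ; ∈-++⁺ʳ)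
open import Data.List.Properties using (length-map; length-++; length-tabulate)
open import Data.List.Relation.Unary.All as All using (All; []; _∷_)
import Data.List.Relation.Unary.All.Properties as All
open import Data.List.Relation.Unary.AllPairs using ([]; _∷_)
open import Data.List.Relation.Unary.Any as Any using (here; there)
import Data.List.Relation.Unary.Any.Properties as Any
open import Data.List.Relation.Unary.Linked using (Linked; []; [-]; _∷_)
open import Data.List.Relation.Unary.Unique.Propositional using (Unique)
open import Data.Maybe.Base using (just)
open import Data.Nat.Base using (ℕ; zero; suc; _≤_; _<_; _+_; _∸_; ⌊_/2⌋; z≤n; s≤s; _⊓_)
open import Data.Nat.Properties as ℕ using (≤-trans; ≤-refl; ≤-reflexive)
open import Data.Nat.Tactic.RingSolver using (solve-∀)
open import Data.Product.Base using (_×_; _,_; ∃; ∃₂; proj₁; proj₂)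
open import Data.Sum.Base as Sum using (_⊎_; inj₁; inj₂; [_,_]; [_,_]′)
open import Data.Sum.Function.Propositional using (_⊎-↔_)
import Data.Sum.Properties as Sum
open import Data.Vec.Base using ([]; _∷_)
open import Function.Base using (_∘_; id)
open import Function.Bundles using (_⇔_; _↔_; mk⇔; Inverse)
open import Function.Construct.Composition using (_↔-∘_)
open import Function.Construct.Identity using (↔-id)
open import Level using (0ℓ)
open import Relation.Binary.Core using (Rel)
open import Relation.Binary.Definitions
  using (Decidable; Irreflexive; Symmetric; DecidableEquality; tri<; tri≈; tri>)
open import Relation.Binary.PropositionalEquality
  using (_≡_; _≢_; refl; sym; trans; cong; cong₂; subst; subst₂)
open import Relation.Nullary using (¬_; yes; no; contradiction)
open import Relation.Nullary.Decidable using (_×-dec_; ¬?; _⊎-dec_; decidable-stable)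
import Relation.Unary as Unary

private variable
  n : ℕ

-- Subsets with two or three elements.

∣p∪q∣≤∣p∣+∣q∣ : (p q : Subset n) → ∣ p ∪ q ∣ ≤ ∣ p ∣ + ∣ q ∣
∣p∪q∣≤∣p∣+∣q∣ []          []          = z≤n
∣p∪q∣≤∣p∣+∣q∣ (true  ∷ p) (true  ∷ q) =
  s≤s (≤-trans (∣p∪q∣≤∣p∣+∣q∣ p q) (ℕ.+-monoʳ-≤ ∣ p ∣ (ℕ.n≤1+n ∣ q ∣)))
∣p∪q∣≤∣p∣+∣q∣ (true  ∷ p) (false ∷ q) = s≤s (∣p∪q∣≤∣p∣+∣q∣ p q)
∣p∪q∣≤∣p∣+∣q∣ (false ∷ p) (true  ∷ q) =
  ≤-trans (s≤s (∣p∪q∣≤∣p∣+∣q∣ p q)) (≤-reflexive (sym (ℕ.+-suc ∣ p ∣ ∣ q ∣)))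
∣p∪q∣≤∣p∣+∣q∣ (false ∷ p) (false ∷ q) = ∣p∪q∣≤∣p∣+∣q∣ p q

∣pair∣≤2 : (x y : Fin n) → ∣ ⁅ x ⁆ ∪ ⁅ y ⁆ ∣ ≤ 2
∣pair∣≤2 x y = ≤-trans (∣p∪q∣≤∣p∣+∣q∣ ⁅ x ⁆ ⁅ y ⁆)
  (≤-reflexive (cong₂ _+_ (∣⁅x⁆∣≡1 x) (∣⁅x⁆∣≡1 y)))

∣q∣<∣p∣⇒p⊈q : (p q : Subset n) → ∣ q ∣ < ∣ p ∣ → ∃ λ x → x ∈ p × x ∉ q
∣q∣<∣p∣⇒p⊈q p q q<p with Fin.any? (λ x → (x ∈? p) ×-dec ¬? (x ∈? q))
... | yes found = found
... | no none = contradiction (p⊆q⇒∣p∣≤∣q∣ p⊆q) (ℕ.<⇒≱ q<p)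
  where
  p⊆q : p ⊆ q
  p⊆q {x} x∈p with x ∈? q
  ... | yes x∈q = x∈q
  ... | no x∉q = contradiction (x , x∈p , x∉q) none

Distinct₃ : {A : Set} → A → A → A → Set
Distinct₃ x y z = x ≢ y × x ≢ z × y ≢ z

x∉⁅y⁆ : {x y : Fin n} → x ≢ y → x ∉ ⁅ y ⁆
x∉⁅y⁆ {y = y} x≢y x∈ = x≢y (x∈⁅y⁆⇒x≡y y x∈)

∣pair∣≡2 : {x y : Fin n} → x ≢ y → ∣ ⁅ x ⁆ ∪ ⁅ y ⁆ ∣ ≡ 2
∣pair∣≡2 {x = x} {y} x≢y = ℕ.≤-antisym (∣pair∣≤2 x y)
  (subst (_< ∣ ⁅ x ⁆ ∪ ⁅ y ⁆ ∣) (∣⁅x⁆∣≡1 x)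
    (p⊂q⇒∣p∣<∣q∣ ((λ z∈ → x∈p∪q⁺ (inj₁ z∈)) , y , x∈p∪q⁺ (inj₂ (x∈⁅x⁆ y)) , x∉⁅y⁆ (x≢y ∘ sym))))

3≤∣p∣⁺ : {p : Subset n} {x y z : Fin n} → Distinct₃ x y z → x ∈ p → y ∈ p → z ∈ p → 3 ≤ ∣ p ∣
3≤∣p∣⁺ {p = p} {x} {y} {z} (x≢y , x≢z , y≢z) x∈p y∈p z∈p =
  subst (_< ∣ p ∣) (∣pair∣≡2 x≢y)
    (p⊂q⇒∣p∣<∣q∣ (pair⊆p , z , z∈p ,
      λ z∈ → [ x∉⁅y⁆ (x≢z ∘ sym) , x∉⁅y⁆ (y≢z ∘ sym) ] (x∈p∪q⁻ ⁅ x ⁆ ⁅ y ⁆ z∈)))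
  where
  pair⊆p : ⁅ x ⁆ ∪ ⁅ y ⁆ ⊆ p
  pair⊆p w∈ = [ (λ w∈x → subst (_∈ p) (sym (x∈⁅y⁆⇒x≡y x w∈x)) x∈p)
              , (λ w∈y → subst (_∈ p) (sym (x∈⁅y⁆⇒x≡y y w∈y)) y∈p) ]
              (x∈p∪q⁻ ⁅ x ⁆ ⁅ y ⁆ w∈)

-- Greedy choice: the empty set, a singleton and a pair are each smaller than `p`, so each misses an
-- element of `p`.
3≤∣p∣⁻ : (p : Subset n) → 3 ≤ ∣ p ∣ →
         ∃ λ x → ∃₂ λ y z → Distinct₃ x y z × x ∈ p × y ∈ p × z ∈ p
3≤∣p∣⁻ {n} p 3≤p
  with x , x∈p , _ ← ∣q∣<∣p∣⇒p⊈q p ⊥ (subst (_< ∣ p ∣) (sym (∣⊥∣≡0 n)) (≤-trans (s≤s z≤n) 3≤p))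
  with y , y∈p , y∉x ← ∣q∣<∣p∣⇒p⊈q p ⁅ x ⁆
         (subst (_< ∣ p ∣) (sym (∣⁅x⁆∣≡1 x)) (≤-trans (s≤s (s≤s z≤n)) 3≤p))
  with z , z∈p , z∉xy ← ∣q∣<∣p∣⇒p⊈q p (⁅ x ⁆ ∪ ⁅ y ⁆) (≤-trans (s≤s (∣pair∣≤2 x y)) 3≤p)
  = x , y , z
  , ( (λ { refl → y∉x (x∈⁅x⁆ x) })
    , (λ { refl → z∉xy (x∈p∪q⁺ (inj₁ (x∈⁅x⁆ x))) })
    , (λ { refl → z∉xy (x∈p∪q⁺ (inj₂ (x∈⁅x⁆ y))) }))
  , x∈p , y∈p , z∈p

∈-⋃⁺ : {x : Fin n} {xs : List (Fin n)} → x List.∈ xs → x ∈ ⋃ (map ⁅_⁆ xs)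
∈-⋃⁺ (here refl) = x∈p∪q⁺ (inj₁ (x∈⁅x⁆ _))
∈-⋃⁺ (there x∈)  = x∈p∪q⁺ (inj₂ (∈-⋃⁺ x∈))

∈-⋃⁻ : {x : Fin n} (xs : List (Fin n)) → x ∈ ⋃ (map ⁅_⁆ xs) → x List.∈ xs
∈-⋃⁻ []       x∈ = contradiction x∈ ∉⊥
∈-⋃⁻ (y ∷ ys) x∈ with x∈p∪q⁻ ⁅ y ⁆ (⋃ (map ⁅_⁆ ys)) x∈
... | inj₁ x∈y  = here (x∈⁅y⁆⇒x≡y y x∈y)
... | inj₂ x∈ys = there (∈-⋃⁻ ys x∈ys)

-- Walks and induced paths over an arbitrary relation.

module Walks {V : Set} (Adj : Rel V 0ℓ) where

  -- Vertices may repeat, unlike in `IsPath`. The list holds every vertex visited, so its length is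
  -- the number of edges plus one.
  data Walk : V → List V → V → Set where
    stop : ∀ {u} → Walk u (u ∷ []) u
    step : ∀ {u w xs v} → Adj u w → Walk w xs v → Walk u (u ∷ xs) v

  Far : Rel V 0ℓ
  Far u v = u ≢ v × ¬ Adj u v

  -- Built vertex by vertex, so that an explicit path is verified by listing its edges and
  -- non-edges; uniqueness and chordlessness are derived from this form.
  data Induced : List V → Set where
    [-]    : ∀ {u} → Induced (u ∷ [])
    _⟨_⟩∷_ : ∀ {u v xs} → Adj u v → All (Far u) xs → Induced (v ∷ xs) → Induced (u ∷ v ∷ xs)

  infixr 5 _⟨_⟩∷_

  walk-1≤length : ∀ {u xs v} → Walk u xs v → 1 ≤ length xs
  walk-1≤length stop       = s≤s z≤n
  walk-1≤length (step _ _) = s≤s z≤n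

  walk-head : ∀ {u v w xs} → Walk u (w ∷ xs) v → u ≡ w
  walk-head stop       = refl
  walk-head (step _ _) = refl

  walk-join : ∀ {u xs v ys w} → Walk u xs v → Walk v ys w →
              ∃ λ zs → Walk u zs w × suc (length zs) ≡ length xs + length ys
  walk-join stop q = _ , q , refl
  walk-join (step a p) q with zs , r , eq ← walk-join p q = _ , step a r , cong suc eq

  walk-reverse : Symmetric Adj → ∀ {u xs v} → Walk u xs v →
                 ∃ λ ys → Walk v ys u × length ys ≡ length xs
  walk-reverse _ stop = _ , stop , refl
  walk-reverse adj-sym (step a p)
    with ys , q , eq ← walk-reverse adj-sym p
    with zs , r , eq′ ← walk-join q (step (adj-sym a) stop)
    = zs , r , trans (ℕ.suc-injective (trans eq′ (ℕ.+-comm (length ys) 2))) (cong suc eq)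

  walk-split : ∀ {u xs v w} → Walk u xs v → w List.∈ xs →
               ∃₂ λ ys zs → Walk u ys w × Walk w zs v × length ys + length zs ≡ suc (length xs)
  walk-split stop       (here refl) = _ , _ , stop , stop , refl
  walk-split (step a p) (here refl) = _ , _ , stop , step a p , refl
  walk-split (step a p) (there w∈) with _ , _ , q , r , eq ← walk-split p w∈
    = _ , _ , step a q , r , cong suc eq

  record Visits (u v w z : V) (ℓ : ℕ) : Set where
    field
      {xs ys zs} : List V
      before  : Walk u xs w
      between : Walk w ys z
      after   : Walk z zs v
      -- The vertices `w` and `z` are each counted in two of the three lists.
      total   : length xs + (length ys + length zs) ≡ 2 + ℓ

  walk-visits : ∀ {u xs v w z} → Walk u xs v → w List.∈ xs → z List.∈ xs →
                Visits u v w z (length xs) ⊎ Visits u v z w (length xs)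
  walk-visits p (here refl) z∈
    with refl ← walk-head p
    with _ , _ , q , r , eq ← walk-split p z∈
    = inj₁ record { before = stop ; between = q ; after = r ; total = cong suc eq }
  walk-visits p w∈@(there _) (here refl)
    with refl ← walk-head p
    with _ , _ , q , r , eq ← walk-split p w∈
    = inj₂ record { before = stop ; between = q ; after = r ; total = cong suc eq }
  walk-visits stop (there ()) _
  walk-visits (step a p) (there w∈) (there z∈) = Sum.map extend extend (walk-visits p w∈ z∈)
    where
    extend : ∀ {w z} → Visits _ _ w z _ → Visits _ _ w z _
    extend vis = record { before = step a before ; between = between ; after = after ; total = cong suc total }
      where open Visits vis

  -- The bound counts vertices, so distance at most `D` reads `ShortWalk (suc D)`.
  ShortWalk : ℕ → V → V → Set
  ShortWalk ℓ u v = ∃ λ xs → Walk u xs v × length xs ≤ ℓ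

  short-reverse : Symmetric Adj → ∀ {ℓ u v} → ShortWalk ℓ u v → ShortWalk ℓ v u
  short-reverse adj-sym (_ , p , p≤ℓ) with ys , q , eq ← walk-reverse adj-sym p =
    ys , q , ≤-trans (≤-reflexive eq) p≤ℓ

  walk-short : Symmetric Adj → ∀ {u xs v w z} → Walk u xs v → w List.∈ xs → z List.∈ xs →
               ShortWalk (length xs) w z
  walk-short adj-sym p w∈ z∈ =
    [ extract , short-reverse adj-sym ∘ extract ] (walk-visits p w∈ z∈)
    where
    middle≤ : ∀ a b c {ℓ} → 1 ≤ a → 1 ≤ c → a + (b + c) ≡ 2 + ℓ → b ≤ ℓ
    middle≤ (suc a) b (suc c) _ _ eq = ≤-trans (≤-trans (ℕ.m≤m+n b c) (ℕ.m≤n+m (b + c) a))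
      (≤-reflexive (ℕ.suc-injective (ℕ.suc-injective (trans (shift a b c) eq))))
      where
      shift : ∀ a b c → 2 + (a + (b + c)) ≡ suc a + (b + suc c)
      shift = solve-∀
    extract : ∀ {u v w z ℓ} → Visits u v w z ℓ → ShortWalk ℓ w z
    extract vis = _ , between , middle≤ (length xs) (length ys) (length zs) (walk-1≤length before) (walk-1≤length after) total
      where open Visits vis

  -- A closed walk joins any two of its vertices in two ways, one of which uses
  -- at most half of its edges.
  closed-walk-short : Symmetric Adj → ∀ {u xs w z} d → Walk u xs u → length xs ≤ 2 + (d + d) →
                      w List.∈ xs → z List.∈ xs → ShortWalk (suc d) w z
  closed-walk-short adj-sym d p p≤2d w∈ z∈ =
    [ extract , short-reverse adj-sym ∘ extract ] (walk-visits p w∈ z∈)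
    where
    half : ∀ a b c {L s} → a + (b + c) ≡ 2 + L → suc s ≡ c + a → L ≤ 2 + (d + d) →
           2 + d ≤ b → s ≤ suc d
    half a b c {L} {s} total eq L≤2d d<b = ℕ.≮⇒≥ λ d<s → ℕ.<⇒≱
      (ℕ.≤-pred (subst₂ _≤_ (double d) (ℕ.suc-injective b+s≡1+L) (ℕ.+-mono-≤ d<b d<s))) L≤2d
      where
      double : ∀ d → (2 + d) + (2 + d) ≡ 4 + (d + d)
      double = solve-∀
      rotate : ∀ a b c → b + (c + a) ≡ a + (b + c)
      rotate = solve-∀
      b+s≡1+L : suc (b + s) ≡ 2 + L
      b+s≡1+L = trans (sym (ℕ.+-suc b s)) (trans (cong (b +_) eq) (trans (rotate a b c) total))
    extract : ∀ {w z} → Visits _ _ w z _ → ShortWalk (suc d) w z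
    extract record { xs = xs ; ys = ys ; zs = zs ; before = before ; between = between ; after = after ; total = total }
      with length ys ℕ.≤? suc d
    ... | yes q≤d = _ , between , q≤d
    ... | no q≰d with _ , back , eq ← walk-join after before =
      short-reverse adj-sym (_ , back , half (length xs) (length ys) (length zs) total eq p≤2d (ℕ.≰⇒> q≰d))

  -- Each edge raises `f` by at most one. This bounds a distance from below without an inspection of
  -- all paths.
  potential-bound : (f : V → ℕ) → (∀ {u v} → Adj u v → f v ≤ suc (f u)) →
                    ∀ {u xs v} → Walk u xs v → suc (f v) ≤ f u + length xs
  potential-bound f lip {u} stop = ≤-reflexive (ℕ.+-comm 1 (f u))
  potential-bound f lip {u} (step {w = w} {xs} a p) = ≤-trans (potential-bound f lip p)
    (≤-trans (ℕ.+-monoˡ-≤ (length xs) (lip a)) (≤-reflexive (sym (ℕ.+-suc (f u) (length xs)))))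

  induced-unique : Irreflexive _≡_ Adj → ∀ {xs} → Induced xs → Unique xs
  induced-unique _ [-] = [] ∷ []
  induced-unique irr (a ⟨ far ⟩∷ ind) =
    ((λ eq → irr eq a) ∷ All.map proj₁ far) ∷ induced-unique irr ind

  induced-linked : ∀ {xs} → Induced xs → Linked Adj xs
  induced-linked [-]           = [-]
  induced-linked (a ⟨ _ ⟩∷ ind) = a ∷ induced-linked ind

  induced-chordless : ∀ {xs} → Induced xs → (i j : Fin (length xs)) → suc (toℕ i) < toℕ j →
                      ¬ Adj (lookup xs i) (lookup xs j)
  induced-chordless [-] zero zero ()
  induced-chordless (_ ⟨ _ ⟩∷ _) _ zero ()
  induced-chordless (_ ⟨ _ ⟩∷ _) zero (suc zero) (s≤s ())
  induced-chordless (_ ⟨ far ⟩∷ _) zero (suc (suc j)) _ = proj₂ (All.lookup far (∈-lookup j))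
  induced-chordless (_ ⟨ _ ⟩∷ ind) (suc i) (suc j) (s≤s i<j) = induced-chordless ind i j i<j

  induced-ends : ∀ {xs} → Induced xs → ∃₂ λ u v → head xs ≡ just u × last xs ≡ just v
  induced-ends ([-] {u}) = u , u , refl , refl
  induced-ends (_⟨_⟩∷_ {u} _ _ ind) with _ , v , _ , eq ← induced-ends ind = u , v , refl , eq

  walk-tabulate : ∀ {m} (f : Fin (suc m) → V) → (∀ i → Adj (f (inject₁ i)) (f (suc i))) →
                  ∀ {xs v} → Walk (f (fromℕ m)) (f (fromℕ m) ∷ xs) v →
                  Walk (f zero) (tabulate f ++ xs) v
  walk-tabulate {zero}  f edges p = p
  walk-tabulate {suc m} f edges p = step (edges zero) (walk-tabulate (f ∘ suc) (edges ∘ suc) p)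

  -- The two pieces share the vertex `f (fromℕ m)`. Its relations to `xs` are part of the second
  -- piece, so the last hypothesis concerns only the earlier vertices, hence `inject₁ i`.
  induced-tabulate : ∀ {m} (f : Fin (suc m) → V) → (∀ i → Adj (f (inject₁ i)) (f (suc i))) →
                     (∀ i j → suc (toℕ i) < toℕ j → Far (f i) (f j)) →
                     ∀ {xs} → Induced (f (fromℕ m) ∷ xs) →
                     (∀ i → All (Far (f (inject₁ i))) xs) →
                     Induced (tabulate f ++ xs)
  induced-tabulate {zero}  f edges far ind cross = ind
  induced-tabulate {suc m} f edges far ind cross =
    edges zero
    ⟨ All.++⁺ (All.tabulate⁺ (λ i → far zero (suc (suc i)) (s≤s (s≤s z≤n)))) (cross zero) ⟩∷
    induced-tabulate (f ∘ suc) (edges ∘ suc) (λ i j i<j → far (suc i) (suc j) (s≤s i<j)) ind (cross ∘ suc)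

open Walks

-- Paths of a graph from walks and induced paths, and a criterion for realisation.

module _ {V W : Set} {Adj : Rel V 0ℓ} {Adj′ : Rel W 0ℓ} (f : V → W)
         (pres : ∀ {u v} → Adj u v → Adj′ (f u) (f v)) where

  walk-map : ∀ {u xs v} → Walk Adj u xs v → Walk Adj′ (f u) (map f xs) (f v)
  walk-map stop       = stop
  walk-map (step a p) = step (pres a) (walk-map p)

  induced-map : (∀ {u v} → Far Adj u v → Far Adj′ (f u) (f v)) →
                ∀ {xs} → Induced Adj xs → Induced Adj′ (map f xs)
  induced-map pres-far [-] = [-]
  induced-map pres-far (a ⟨ far ⟩∷ ind) =
    pres a ⟨ All.map⁺ (All.map pres-far far) ⟩∷ induced-map pres-far ind

module _ (G : Graph n) where
  open Graph G using (Adj; irrefl)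

  walk⇒isPath : ∀ {u xs v} → Walk Adj u xs v → Unique xs → IsPath G u v xs
  walk⇒isPath p unique = record { starts = starts p ; ends = ends p ; linked = linked p ; unique = unique }
    where
    starts : ∀ {u xs v} → Walk Adj u xs v → head xs ≡ just u
    starts stop       = refl
    starts (step _ _) = refl
    ends : ∀ {u xs v} → Walk Adj u xs v → last xs ≡ just v
    ends stop                  = refl
    ends (step _ stop)         = refl
    ends (step _ p@(step _ _)) = ends p
    linked : ∀ {u xs v} → Walk Adj u xs v → Linked Adj xs
    linked stop                  = [-]
    linked (step a stop)         = a ∷ [-]
    linked (step a p@(step _ _)) = a ∷ linked p

  isPath⇒walk : ∀ {u v xs} → IsPath G u v xs → Walk Adj u xs v
  isPath⇒walk path = go (IsPath.linked path) (IsPath.starts path) (IsPath.ends path)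
    where
    go : ∀ {u v xs} → Linked Adj xs → head xs ≡ just u → last xs ≡ just v → Walk Adj u xs v
    go [-]           refl refl = stop
    go (a ∷ linked)  refl eq   = step a (go linked refl eq)

  -- Loop erasure: when a new first vertex already occurs in the shortened walk, everything before
  -- that occurrence is cut off.
  walk⇒path : ∀ {u xs v} → Walk Adj u xs v → ∃ λ ys → IsPath G u v ys × length ys ≤ length xs
  walk⇒path p = let ys , q , unique , ≤xs = go p in ys , walk⇒isPath q unique , ≤xs
    where
    UniqueWalk : Fin n → Fin n → ℕ → Set
    UniqueWalk u v ℓ = ∃ λ ys → Walk Adj u ys v × Unique ys × length ys ≤ ℓ

    suffix : ∀ {u xs v w} → Walk Adj u xs v → Unique xs → w List.∈ xs → UniqueWalk w v (length xs)
    suffix stop       unique       (here refl) = _ , stop , unique , ≤-refl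
    suffix (step a p) unique       (here refl) = _ , step a p , unique , ≤-refl
    suffix (step a p) (_ ∷ unique) (there w∈)
      with ys , q , unique′ , ≤xs ← suffix p unique w∈ = ys , q , unique′ , ℕ.m≤n⇒m≤1+n ≤xs

    go : ∀ {u xs v} → Walk Adj u xs v → UniqueWalk u v (length xs)
    go stop = _ , stop , [] ∷ [] , ≤-refl
    go (step {u} a p) with ys , q , unique , ≤xs ← go p with ∈-dec Fin._≟_ u ys
    ... | yes u∈ys with zs , r , unique′ , ≤ys ← suffix q unique u∈ys
                   = zs , r , unique′ , ℕ.m≤n⇒m≤1+n (≤-trans ≤ys ≤xs)
    ... | no u∉ys = _ , step a q , All.¬Any⇒All¬ ys u∉ys ∷ unique , s≤s ≤xs

  induced⇒monophonic : ∀ {xs} → Induced Adj xs → ∃₂ λ u v → IsMonophonicPath G u v xs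
  induced⇒monophonic ind with u , v , starts , ends ← induced-ends Adj ind =
    u , v , record { starts = starts ; ends = ends ; linked = induced-linked Adj ind
                   ; unique = induced-unique Adj irrefl ind }
          , induced-chordless Adj ind

-- Reduces a realisation to data on a convenient vertex type: common induced paths for any three
-- vertices give position number 2, short walks bound the diameter from above, and the potential `f`
-- bounds the distance from `u₀` to `v₀` from below.
module Realisation {V : Set} (Adj : Rel V 0ℓ) (adj-sym : Symmetric Adj)
  (adj-irrefl : Irreflexive _≡_ Adj) (_~?_ : Decidable Adj)
  (vertices : Fin n ↔ V) (D : ℕ) (1≤D : 1 ≤ D)
  (collinear : ∀ u v w → ∃ λ xs → Induced Adj xs × u List.∈ xs × v List.∈ xs × w List.∈ xs)
  (short : ∀ u v → ShortWalk Adj (suc D) u v)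
  (f : V → ℕ) (lipschitz : ∀ {u v} → Adj u v → f v ≤ suc (f u))
  (u₀ v₀ : V) (f-u₀ : f u₀ ≡ 0) (f-v₀ : D ≤ f v₀)
  where

  open Inverse vertices using (to; from; strictlyInverseˡ; strictlyInverseʳ)

  graph : Graph n
  graph = record
    { Adj    = λ i j → Adj (to i) (to j)
    ; sym    = adj-sym
    ; irrefl = λ { refl → adj-irrefl refl }
    ; adj?   = λ i j → to i ~? to j
    }

  open Graph graph using () renaming (Adj to Adj′)

  from-pres : ∀ {u v} → Adj u v → Adj′ (from u) (from v)
  from-pres = subst₂ Adj (sym (strictlyInverseˡ _)) (sym (strictlyInverseˡ _))

  from-far : ∀ {u v} → Far Adj u v → Far Adj′ (from u) (from v)
  from-far (u≢v , ¬a) =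
    (λ eq → u≢v (trans (sym (strictlyInverseˡ _)) (trans (cong to eq) (strictlyInverseˡ _)))) ,
    (λ a → ¬a (subst₂ Adj (strictlyInverseˡ _) (strictlyInverseˡ _) a))

  ∈-from : ∀ {i xs} → to i List.∈ xs → i List.∈ map from xs
  ∈-from i∈ = subst (List._∈ _) (strictlyInverseʳ _) (∈-map⁺ from i∈)

  short′ : ∀ i j → ∃ λ xs → IsPath graph i j xs × length xs ≤ suc D
  short′ i j
    with xs , p , ≤D ← short (to i) (to j)
    with ys , q , ≤xs ← walk⇒path graph (walk-map from from-pres p)
    = ys , subst₂ (λ u v → IsPath graph u v ys) (strictlyInverseʳ i) (strictlyInverseʳ j) q
    , ≤-trans ≤xs (≤-trans (≤-reflexive (length-map from xs)) ≤D)

  long : ∀ {xs} → IsPath graph (from u₀) (from v₀) xs → suc D ≤ length xs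
  long {xs} path = ≤-trans (s≤s f-v₀)
    (subst₂ (λ a b → suc (f b) ≤ a + length xs)
      (trans (cong f (strictlyInverseˡ u₀)) f-u₀) (strictlyInverseˡ v₀)
      (potential-bound Adj′ (f ∘ to) lipschitz (isPath⇒walk graph path)))

  diameter : HasDiameter graph D
  diameter = (λ i j → _ , proj₁ (proj₂ (short′ i j)))
           , (from u₀ , from v₀ , attained , λ xs → long)
           , λ i j d (_ , minimal) → ℕ.≤-pred
               (≤-trans (minimal _ (proj₁ (proj₂ (short′ i j)))) (proj₂ (proj₂ (short′ i j))))
    where
    attained : ∃ λ xs → IsPath graph (from u₀) (from v₀) xs × length xs ≡ suc D
    attained with xs , path , ≤D ← short′ (from u₀) (from v₀) =
      xs , path , ℕ.≤-antisym ≤D (long path)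

  from-u₀≢from-v₀ : from u₀ ≢ from v₀
  from-u₀≢from-v₀ eq = ℕ.<⇒≱ (≤-trans 1≤D f-v₀)
    (≤-reflexive (trans (cong f (trans (sym (strictlyInverseˡ v₀))
      (trans (cong to (sym eq)) (strictlyInverseˡ u₀)))) f-u₀))

  positionNumber : HasMonophonicPositionNumber graph 2
  positionNumber = (pair , (λ _ _ xs _ → ≤-trans (∣p∩q∣≤∣p∣ pair _) (∣pair∣≤2 (from u₀) (from v₀))) , ∣pair∣≡2 from-u₀≢from-v₀)
                 , λ S mono → ℕ.≮⇒≥ λ 3≤S → no-triple S mono (3≤∣p∣⁻ S 3≤S)
    where
    pair : Subset n
    pair = ⁅ from u₀ ⁆ ∪ ⁅ from v₀ ⁆
    no-triple : ∀ S → InMonophonicPosition graph S →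
                ¬ (∃ λ x → ∃₂ λ y z → Distinct₃ x y z × x ∈ S × y ∈ S × z ∈ S)
    no-triple S mono (x , y , z , distinct , x∈S , y∈S , z∈S)
      with xs , ind , x∈ , y∈ , z∈ ← collinear (to x) (to y) (to z)
      with u , v , path ← induced⇒monophonic graph (induced-map from from-pres from-far ind)
      = ℕ.<⇒≱ (3≤∣p∣⁺ distinct (x∈p∩q⁺ (x∈S , ∈-⋃⁺ (∈-from x∈)))
                  (x∈p∩q⁺ (y∈S , ∈-⋃⁺ (∈-from y∈))) (x∈p∩q⁺ (z∈S , ∈-⋃⁺ (∈-from z∈))))
              (mono u v _ path)

  realised : ∃ λ (G : Graph n) → HasMonophonicPositionNumber G 2 × HasDiameter G D
  realised = graph , positionNumber , diameter


-- Path graphs.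

module PathGraph (D : ℕ) (1≤D : 1 ≤ D) where

  V : Set
  V = Fin (suc D)

  Adj : Rel V 0ℓ
  Adj i j = suc (toℕ i) ≡ toℕ j ⊎ suc (toℕ j) ≡ toℕ i

  edges : ∀ i → Adj (inject₁ i) (suc i)
  edges i = inj₁ (cong suc (Fin.toℕ-inject₁ i))

  far : ∀ i j → suc (toℕ i) < toℕ j → Far Adj i j
  far i j i<j = (λ { refl → ℕ.<⇒≱ i<j (ℕ.n≤1+n _) })
              , [ (λ eq → ℕ.<⇒≢ i<j eq)
                , (λ eq → ℕ.<⇒≱ i<j (≤-trans (ℕ.n≤1+n _) (≤-trans (≤-reflexive eq) (ℕ.n≤1+n _)))) ]

  line : List V
  line = tabulate id ++ []

  ∈-line : ∀ i → i List.∈ line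
  ∈-line i = ∈-++⁺ˡ {xs = tabulate id} (∈-tabulate⁺ {f = id} i)

  short : ∀ u v → ShortWalk Adj (suc D) u v
  short u v = subst (λ ℓ → ShortWalk Adj ℓ u v)
    (trans (length-++ (tabulate {n = suc D} id)) (trans (ℕ.+-identityʳ _) (length-tabulate id)))
    (walk-short Adj Sum.swap (walk-tabulate Adj id edges stop) (∈-line u) (∈-line v))

  lipschitz : ∀ {i j} → Adj i j → toℕ j ≤ suc (toℕ i)
  lipschitz (inj₁ eq) = ≤-reflexive (sym eq)
  lipschitz (inj₂ eq) = ≤-trans (ℕ.n≤1+n _) (≤-trans (≤-reflexive eq) (ℕ.n≤1+n _))

  realised : ∃ λ (G : Graph (suc D)) → HasMonophonicPositionNumber G 2 × HasDiameter G D
  realised = Realisation.realised Adj Sum.swap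
    (λ { refl → [ ℕ.1+n≢n , ℕ.1+n≢n ] })
    (λ i j → (suc (toℕ i) ℕ.≟ toℕ j) ⊎-dec (suc (toℕ j) ℕ.≟ toℕ i))
    (↔-id _) D 1≤D
    (λ u v w → line , induced-tabulate Adj id edges far [-] (λ _ → []) , ∈-line u , ∈-line v , ∈-line w)
    short toℕ lipschitz zero (fromℕ D) refl (≤-reflexive (sym (Fin.toℕ-fromℕ D)))

-- Subdivided crown graphs.

injective-avoids-three : {A : Set} → DecidableEquality A → (g : Fin 4 → A) →
                         (∀ {c d} → g c ≡ g d → c ≡ d) →
                         ∀ u v w → ∃ λ c → g c ≢ u × g c ≢ v × g c ≢ w
injective-avoids-three {A} _≟_ g g-inj u v w
  with Fin.any? (λ c → ¬? (g c ≟ u) ×-dec ¬? (g c ≟ v) ×-dec ¬? (g c ≟ w))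
... | yes found = found
... | no none =
  -- If all four values were among `u`, `v`, `w`, two of them would coincide.
  let c , d , c<d , eq = Fin.pigeonhole (s≤s (s≤s (s≤s (s≤s z≤n)))) (proj₁ ∘ hit) in
  contradiction (g-inj (trans (proj₂ (hit c)) (trans (cong target eq) (sym (proj₂ (hit d))))))
                (Fin.<⇒≢ c<d)
  where
  target : Fin 3 → A
  target zero             = u
  target (suc zero)       = v
  target (suc (suc zero)) = w
  hit : ∀ c → ∃ λ i → g c ≡ target i
  hit c with g c ≟ u | g c ≟ v | g c ≟ w
  ... | yes eq | _      | _      = zero , eq
  ... | no _   | yes eq | _      = suc zero , eq
  ... | no _   | no _   | yes eq = suc (suc zero) , eq
  ... | no ≢u  | no ≢v  | no ≢w  = contradiction (c , ≢u , ≢v , ≢w) none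

-- The crown graph K_{m+2,m+2} minus a perfect matching, with one edge x y
-- subdivided k times. Its sides are {t , x , a j} and {s , y , b j}, the removed
-- matching consists of t y, x s and all a j b j, and the vertices r i form the
-- path from x to y that replaces the edge.
module Crown (k h : ℕ) where

  -- A successor, so that there is at least one pair `a j`, `b j` and hence a cycle to work with.
  m : ℕ
  m = suc h

  -- The first summand holds x, the `k` subdividing vertices and y, in this order.
  V : Set
  V = Fin (2 + k) ⊎ (Fin 2 ⊎ (Fin m ⊎ Fin m))

  pattern r i = inj₁ i
  pattern s   = inj₂ (inj₁ zero)
  pattern t   = inj₂ (inj₁ (suc zero))
  pattern a j = inj₂ (inj₂ (inj₁ j))
  pattern b j = inj₂ (inj₂ (inj₂ j))

  -- Each edge is listed in one direction and `Adj` symmetrises. The vertex y is recognised by an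
  -- equation on `toℕ i`, which keeps the index a variable in case analyses.
  data _⟶_ : V → V → Set where
    r⟶r : ∀ {i j} → suc (toℕ i) ≡ toℕ j → r i ⟶ r j
    r⟶a : ∀ {i j} → toℕ i ≡ suc k → r i ⟶ a j
    b⟶r : ∀ {j} → b j ⟶ r zero
    s⟶t : s ⟶ t
    s⟶a : ∀ {j} → s ⟶ a j
    t⟶b : ∀ {j} → t ⟶ b j
    a⟶b : ∀ {i j} → i ≢ j → a i ⟶ b j

  Adj : Rel V 0ℓ
  Adj u v = u ⟶ v ⊎ v ⟶ u

  _⟶?_ : Decidable _⟶_
  r i ⟶? r j with suc (toℕ i) ℕ.≟ toℕ j
  ... | yes eq = yes (r⟶r eq)
  ... | no neq = no λ { (r⟶r eq) → neq eq }
  r i ⟶? a j with toℕ i ℕ.≟ suc k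
  ... | yes eq = yes (r⟶a eq)
  ... | no neq = no λ { (r⟶a eq) → neq eq }
  a i ⟶? b j with i Fin.≟ j
  ... | yes eq = no λ { (a⟶b neq) → neq eq }
  ... | no neq = yes (a⟶b neq)
  b j ⟶? r zero = yes b⟶r
  s ⟶? t = yes s⟶t
  s ⟶? a j = yes s⟶a
  t ⟶? b j = yes t⟶b
  b j ⟶? r (suc i) = no λ ()
  r i ⟶? s = no λ ()
  r i ⟶? t = no λ ()
  r i ⟶? b j = no λ ()
  s ⟶? r j = no λ ()
  s ⟶? s = no λ ()
  s ⟶? b j = no λ ()
  t ⟶? r j = no λ ()
  t ⟶? s = no λ ()
  t ⟶? t = no λ ()
  t ⟶? a j = no λ ()
  a i ⟶? r j = no λ ()
  a i ⟶? s = no λ ()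
  a i ⟶? t = no λ ()
  a i ⟶? a j = no λ ()
  b i ⟶? s = no λ ()
  b i ⟶? t = no λ ()
  b i ⟶? a j = no λ ()
  b i ⟶? b j = no λ ()

  irrefl : Irreflexive _≡_ Adj
  irrefl refl = [ loopless , loopless ]
    where
    loopless : ∀ {u} → ¬ (u ⟶ u)
    loopless (r⟶r eq) = ℕ.1+n≢n eq

  far-sym : ∀ {u v} → Far Adj u v → Far Adj v u
  far-sym (u≢v , ¬adj) = u≢v ∘ sym , ¬adj ∘ Sum.swap

  far-rr : ∀ i j → suc (toℕ i) < toℕ j → Far Adj (r i) (r j)
  far-rr i j i<j = (λ { refl → ℕ.<⇒≱ i<j (ℕ.n≤1+n _) })
    , [ (λ { (r⟶r eq) → ℕ.<⇒≢ i<j eq })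
      , (λ { (r⟶r eq) → ℕ.<⇒≱ i<j (≤-trans (ℕ.n≤1+n _) (≤-trans (≤-reflexive eq) (ℕ.n≤1+n _))) }) ]

  far-ra : ∀ {i j} → toℕ i ≢ suc k → Far Adj (r i) (a j)
  far-ra i≢last = (λ ()) , [ (λ { (r⟶a eq) → i≢last eq }) , (λ ()) ]

  far-rb : ∀ {i j} → Far Adj (r (suc i)) (b j)
  far-rb = (λ ()) , [ (λ ()) , (λ ()) ]

  far-rs : ∀ {i} → Far Adj (r i) s
  far-rs = (λ ()) , [ (λ ()) , (λ ()) ]

  far-rt : ∀ {i} → Far Adj (r i) t
  far-rt = (λ ()) , [ (λ ()) , (λ ()) ]

  far-sb : ∀ {j} → Far Adj s (b j)
  far-sb = (λ ()) , [ (λ ()) , (λ ()) ]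

  far-ta : ∀ {j} → Far Adj t (a j)
  far-ta = (λ ()) , [ (λ ()) , (λ ()) ]

  far-aa : ∀ {i j} → i ≢ j → Far Adj (a i) (a j)
  far-aa i≢j = (λ { refl → i≢j refl }) , [ (λ ()) , (λ ()) ]

  far-bb : ∀ {i j} → i ≢ j → Far Adj (b i) (b j)
  far-bb i≢j = (λ { refl → i≢j refl }) , [ (λ ()) , (λ ()) ]

  far-ab : ∀ {j} → Far Adj (a j) (b j)
  far-ab = (λ ()) , [ (λ { (a⟶b neq) → neq refl }) , (λ ()) ]

  inject₁≢last : ∀ i → toℕ (inject₁ {suc k} i) ≢ suc k
  inject₁≢last i eq = ℕ.<⇒≢ (Fin.toℕ<n i) (trans (sym (Fin.toℕ-inject₁ i)) eq)

  x y : V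
  x = r zero
  y = r (fromℕ (suc k))

  x~b : ∀ {j} → Adj x (b j)
  x~b = inj₂ b⟶r

  y~a : ∀ {j} → Adj y (a j)
  y~a = inj₁ (r⟶a (Fin.toℕ-fromℕ (suc k)))

  a~b : ∀ {i j} → i ≢ j → Adj (a i) (b j)
  a~b = inj₁ ∘ a⟶b

  b~a : ∀ {i j} → i ≢ j → Adj (b i) (a j)
  b~a i≢j = inj₂ (a⟶b (i≢j ∘ sym))

  -- The two shorter versions leave out y and x respectively: y is adjacent to every `a j` and x to
  -- every `b j`, so an induced path through several of these may have to avoid that end.
  spine spine-init spine-tail : List V
  spine      = tabulate {n = 2 + k} inj₁
  spine-init = tabulate {n = 1 + k} (λ i → r (inject₁ i))
  spine-tail = tabulate {n = 1 + k} (λ i → r (suc i))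

  r~r : ∀ i → Adj (r (inject₁ i)) (r (suc i))
  r~r i = inj₁ (r⟶r (cong suc (Fin.toℕ-inject₁ i)))

  spine-++ : ∀ {zs} → Induced Adj (y ∷ zs) → (∀ i → All (Far Adj (r (inject₁ i))) zs) →
             Induced Adj (spine ++ zs)
  spine-++ = induced-tabulate Adj inj₁ r~r far-rr

  spine-tail-++ : ∀ {zs} → Induced Adj (y ∷ zs) → (∀ i → All (Far Adj (r (suc (inject₁ i)))) zs) →
                  Induced Adj (spine-tail ++ zs)
  spine-tail-++ = induced-tabulate Adj (λ i → r (suc i)) (r~r ∘ suc)
    (λ i j i<j → far-rr (suc i) (suc j) (s≤s i<j))

  spine-init-induced : Induced Adj (spine-init ++ [])
  spine-init-induced = induced-tabulate Adj (λ i → r (inject₁ i)) (r~r ∘ inject₁)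
    (λ i j i<j → far-rr (inject₁ i) (inject₁ j)
      (subst₂ (λ p q → suc p < q) (sym (Fin.toℕ-inject₁ i)) (sym (Fin.toℕ-inject₁ j)) i<j))
    [-] (λ _ → [])

  b-spine : ∀ {j zs} → Induced Adj (spine ++ zs) → All (Far Adj (b j)) zs →
            Induced Adj (b j ∷ spine ++ zs)
  b-spine ind far = inj₁ b⟶r ⟨ All.++⁺ (All.tabulate⁺ (λ i → far-sym (far-rb {i}))) far ⟩∷ ind

  tb-spine : ∀ {j zs} → Induced Adj (b j ∷ spine ++ zs) → All (Far Adj t) zs →
             Induced Adj (t ∷ b j ∷ spine ++ zs)
  tb-spine ind far = inj₁ t⟶b ⟨ All.++⁺ (All.tabulate⁺ (λ i → far-sym (far-rt {i}))) far ⟩∷ ind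

  -- The cycle s, t, b j, spine, a j (back to s), cut open by omitting one of
  -- a j, s, t, b j.
  arc : Fin m → Fin 4 → List V
  arc j zero                   = s ∷ t ∷ b j ∷ spine ++ []
  arc j (suc zero)             = t ∷ b j ∷ spine ++ a j ∷ []
  arc j (suc (suc zero))       = b j ∷ spine ++ a j ∷ s ∷ []
  arc j (suc (suc (suc zero))) = spine ++ a j ∷ s ∷ t ∷ []

  omitted : Fin m → Fin 4 → V
  omitted j zero                   = a j
  omitted j (suc zero)             = s
  omitted j (suc (suc zero))       = t
  omitted j (suc (suc (suc zero))) = b j

  y-as : ∀ {j zs} → All (Far Adj (a j)) zs → All (Far Adj y) zs → Induced Adj (s ∷ zs) →
         Induced Adj (y ∷ a j ∷ s ∷ zs)
  y-as far-a far-y ind = y~a ⟨ far-rs ∷ far-y ⟩∷ inj₂ s⟶a ⟨ far-a ⟩∷ ind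

  arc-induced : ∀ j c → Induced Adj (arc j c)
  arc-induced j zero = inj₁ s⟶t
    ⟨ far-sb ∷ All.++⁺ {xs = spine} (All.tabulate⁺ (λ i → far-sym (far-rs {i}))) [] ⟩∷
    tb-spine (b-spine (spine-++ [-] (λ _ → [])) []) []
  arc-induced j (suc zero) =
    tb-spine (b-spine (spine-++ (y~a ⟨ [] ⟩∷ [-]) (λ i → far-ra (inject₁≢last i) ∷ []))
                      (far-sym far-ab ∷ []))
             (far-ta ∷ [])
  arc-induced j (suc (suc zero)) =
    b-spine (spine-++ (y-as [] [] [-]) (λ i → far-ra (inject₁≢last i) ∷ far-rs ∷ []))
            (far-sym far-ab ∷ far-sym far-sb ∷ [])
  arc-induced j (suc (suc (suc zero))) =
    spine-++ (y-as (far-sym far-ta ∷ []) (far-rt ∷ []) (inj₁ s⟶t ⟨ [] ⟩∷ [-]))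
             (λ i → far-ra (inject₁≢last i) ∷ far-rs ∷ far-rt ∷ [])

  data OnCycle (j : Fin m) : V → Set where
    on-r : ∀ i → OnCycle j (r i)
    on-s : OnCycle j s
    on-t : OnCycle j t
    on-a : OnCycle j (a j)
    on-b : OnCycle j (b j)

  ∈-spine : ∀ {zs} i → r i List.∈ spine ++ zs
  ∈-spine i = ∈-++⁺ˡ {xs = spine} (∈-tabulate⁺ {f = inj₁} i)

  ∈-arc : ∀ {j v} → OnCycle j v → ∀ c → omitted j c ≢ v → v List.∈ arc j c
  ∈-arc (on-r i) zero                   _ = there (there (there (∈-spine i)))
  ∈-arc (on-r i) (suc zero)             _ = there (there (∈-spine i))
  ∈-arc (on-r i) (suc (suc zero))       _ = there (∈-spine i)
  ∈-arc (on-r i) (suc (suc (suc zero))) _ = ∈-spine i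
  ∈-arc on-s zero                   _  = here refl
  ∈-arc on-s (suc zero)             ≢s = contradiction refl ≢s
  ∈-arc on-s (suc (suc zero))       _  = there (∈-++⁺ʳ spine (there (here refl)))
  ∈-arc on-s (suc (suc (suc zero))) _  = ∈-++⁺ʳ spine (there (here refl))
  ∈-arc on-t zero                   _  = there (here refl)
  ∈-arc on-t (suc zero)             _  = here refl
  ∈-arc on-t (suc (suc zero))       ≢t = contradiction refl ≢t
  ∈-arc on-t (suc (suc (suc zero))) _  = ∈-++⁺ʳ spine (there (there (here refl)))
  ∈-arc on-a zero                   ≢a = contradiction refl ≢a
  ∈-arc on-a (suc zero)             _  = there (there (∈-++⁺ʳ spine (here refl)))
  ∈-arc on-a (suc (suc zero))       _  = there (∈-++⁺ʳ spine (here refl))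
  ∈-arc on-a (suc (suc (suc zero))) _  = ∈-++⁺ʳ spine (here refl)
  ∈-arc on-b zero                   _  = there (there (here refl))
  ∈-arc on-b (suc zero)             _  = there (here refl)
  ∈-arc on-b (suc (suc zero))       _  = here refl
  ∈-arc on-b (suc (suc (suc zero))) ≢b = contradiction refl ≢b

  omitted-injective : ∀ j {c d} → omitted j c ≡ omitted j d → c ≡ d
  omitted-injective j {c} {d} eq = trans (sym (code-omitted c)) (trans (cong code eq) (code-omitted d))
    where
    code : V → Fin 4
    -- Arbitrary value, since no `r i` is ever omitted.
    code (r _) = zero
    code (a _) = zero
    code s     = suc zero
    code t     = suc (suc zero)
    code (b _) = suc (suc (suc zero))
    code-omitted : ∀ c → code (omitted j c) ≡ c
    code-omitted zero                   = refl
    code-omitted (suc zero)             = refl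
    code-omitted (suc (suc zero))       = refl
    code-omitted (suc (suc (suc zero))) = refl

  _≟_ : DecidableEquality V
  _≟_ = Sum.≡-dec Fin._≟_ (Sum.≡-dec Fin._≟_ (Sum.≡-dec Fin._≟_ Fin._≟_))

  Collinear : V → V → V → Set
  Collinear u v w = ∃ λ xs → Induced Adj xs × u List.∈ xs × v List.∈ xs × w List.∈ xs

  collinear-swap : ∀ {u v w} → Collinear u v w → Collinear v u w
  collinear-swap (_ , ind , u∈ , v∈ , w∈) = _ , ind , v∈ , u∈ , w∈

  collinear-rotate : ∀ {u v w} → Collinear u v w → Collinear v w u
  collinear-rotate (_ , ind , u∈ , v∈ , w∈) = _ , ind , v∈ , w∈ , u∈

  -- The cycle can be cut at four different vertices, and at most three of them have to be kept.
  cycle-collinear : ∀ {j u v w} → OnCycle j u → OnCycle j v → OnCycle j w → Collinear u v w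
  cycle-collinear {j} on-u on-v on-w
    with c , ≢u , ≢v , ≢w ← injective-avoids-three _≟_ (omitted j) (omitted-injective j) _ _ _ =
    arc j c , arc-induced j c , ∈-arc on-u c ≢u , ∈-arc on-v c ≢v , ∈-arc on-w c ≢w

  -- Contains `a i`, `a j` and `b i`, so it serves two a's as well as an a and a b of different
  -- indices. The end y is left out, being adjacent to both a's.
  asab-spine : ∀ {i j} → i ≢ j → Induced Adj (a i ∷ s ∷ a j ∷ b i ∷ spine-init ++ [])
  asab-spine i≢j =
    inj₂ s⟶a ⟨ far-aa i≢j ∷ far-ab ∷ All.++⁺ (All.tabulate⁺ (λ q → far-sym (far-ra (inject₁≢last q)))) [] ⟩∷
    inj₁ s⟶a ⟨ far-sb ∷ All.++⁺ {xs = spine-init} (All.tabulate⁺ (λ q → far-sym (far-rs {inject₁ q}))) [] ⟩∷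
    a~b (i≢j ∘ sym) ⟨ All.++⁺ (All.tabulate⁺ (λ q → far-sym (far-ra (inject₁≢last q)))) [] ⟩∷
    inj₁ b⟶r ⟨ All.++⁺ (All.tabulate⁺ (λ q → far-sym far-rb)) [] ⟩∷
    spine-init-induced

  -- The reversed image of `asab-spine` under the symmetry that exchanges a with b, s with t and x
  -- with y. In the same way `bxbas` and `babab` are the images of `ayabt` and `ababa`.
  spine-abtb : ∀ {i j} → i ≢ j → Induced Adj (spine-tail ++ a i ∷ b j ∷ t ∷ b i ∷ [])
  spine-abtb i≢j = spine-tail-++
    (y~a ⟨ far-rb ∷ far-rt ∷ far-rb ∷ [] ⟩∷
     a~b i≢j ⟨ far-sym far-ta ∷ far-ab ∷ [] ⟩∷
     inj₂ t⟶b ⟨ far-bb (i≢j ∘ sym) ∷ [] ⟩∷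
     inj₁ t⟶b ⟨ [] ⟩∷ [-])
    (λ q → far-ra (inject₁≢last (suc q)) ∷ far-rb ∷ far-rt ∷ far-rb ∷ [])

  -- Covers the triples of `a i`, `a j` with y or t, which `asab-spine` misses.
  ayabt : ∀ {i j} → i ≢ j → Induced Adj (a i ∷ y ∷ a j ∷ b i ∷ t ∷ [])
  ayabt i≢j =
    Sum.swap y~a ⟨ far-aa i≢j ∷ far-ab ∷ far-sym far-ta ∷ [] ⟩∷
    y~a ⟨ far-rb ∷ far-rt ∷ [] ⟩∷
    a~b (i≢j ∘ sym) ⟨ far-sym far-ta ∷ [] ⟩∷
    inj₂ t⟶b ⟨ [] ⟩∷ [-]

  bxbas : ∀ {i j} → i ≢ j → Induced Adj (b i ∷ x ∷ b j ∷ a i ∷ s ∷ [])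
  bxbas i≢j =
    Sum.swap x~b ⟨ far-bb i≢j ∷ far-sym far-ab ∷ far-sym far-sb ∷ [] ⟩∷
    x~b ⟨ far-ra (λ ()) ∷ far-rs ∷ [] ⟩∷
    b~a (i≢j ∘ sym) ⟨ far-sym far-sb ∷ [] ⟩∷
    inj₂ s⟶a ⟨ [] ⟩∷ [-]

  -- Contains both vertices of the rungs `i` and `j`, which settles three rung vertices with only
  -- two indices among them.
  abtba : ∀ {i j} → i ≢ j → Induced Adj (a i ∷ b j ∷ t ∷ b i ∷ a j ∷ [])
  abtba i≢j =
    a~b i≢j ⟨ far-sym far-ta ∷ far-ab ∷ far-aa i≢j ∷ [] ⟩∷
    inj₂ t⟶b ⟨ far-bb (i≢j ∘ sym) ∷ far-sym far-ab ∷ [] ⟩∷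
    inj₁ t⟶b ⟨ far-ta ∷ [] ⟩∷
    b~a i≢j ⟨ [] ⟩∷ [-]

  -- Contains both vertices of the rungs `i` and `l` together with `a j`, which settles three
  -- distinct indices when the vertex of index `j` is an a; `babab` does so when it is a b.
  ababa : ∀ {i j l} → i ≢ j → i ≢ l → j ≢ l → Induced Adj (a i ∷ b l ∷ a j ∷ b i ∷ a l ∷ [])
  ababa i≢j i≢l j≢l =
    a~b i≢l ⟨ far-aa i≢j ∷ far-ab ∷ far-aa i≢l ∷ [] ⟩∷
    b~a (j≢l ∘ sym) ⟨ far-bb (i≢l ∘ sym) ∷ far-sym far-ab ∷ [] ⟩∷
    a~b (i≢j ∘ sym) ⟨ far-aa j≢l ∷ [] ⟩∷
    b~a i≢l ⟨ [] ⟩∷ [-]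

  babab : ∀ {i j l} → i ≢ j → i ≢ l → j ≢ l → Induced Adj (b i ∷ a l ∷ b j ∷ a i ∷ b l ∷ [])
  babab i≢j i≢l j≢l =
    b~a i≢l ⟨ far-bb i≢j ∷ far-sym far-ab ∷ far-bb i≢l ∷ [] ⟩∷
    a~b (j≢l ∘ sym) ⟨ far-aa (i≢l ∘ sym) ∷ far-ab ∷ [] ⟩∷
    b~a (i≢j ∘ sym) ⟨ far-bb j≢l ∷ [] ⟩∷
    a~b i≢l ⟨ [] ⟩∷ [-]

  data Rung (j : Fin m) : V → Set where
    rung-a : Rung j (a j)
    rung-b : Rung j (b j)

  pattern 1st = here refl
  pattern 2nd = there 1st
  pattern 3rd = there 2nd
  pattern 4th = there 3rd
  pattern 5th = there 4th

  ∈-init : ∀ {zs} q → r (inject₁ q) List.∈ spine-init ++ zs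
  ∈-init q = ∈-++⁺ˡ {xs = spine-init} (∈-tabulate⁺ {f = λ i → r (inject₁ i)} q)

  ∈-tail : ∀ {zs} q → r (suc q) List.∈ spine-tail ++ zs
  ∈-tail q = ∈-++⁺ˡ {xs = spine-tail} (∈-tabulate⁺ {f = λ i → r (suc i)} q)

  after-tail : ∀ {v zs} → v List.∈ zs → v List.∈ spine-tail ++ zs
  after-tail = ∈-++⁺ʳ spine-tail

  first-∈-abtba : ∀ {i j u} → Rung i u → u List.∈ a i ∷ b j ∷ t ∷ b i ∷ a j ∷ []
  first-∈-abtba rung-a = 1st
  first-∈-abtba rung-b = 4th

  second-∈-abtba : ∀ {i j v} → Rung j v → v List.∈ a i ∷ b j ∷ t ∷ b i ∷ a j ∷ []
  second-∈-abtba rung-a = 5th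
  second-∈-abtba rung-b = 2nd

  three-rungs : ∀ {i j l u v w} → i ≢ j → Rung i u → Rung j v → Rung l w → Collinear u v w
  three-rungs {i} {j} {l} i≢j u v w with i Fin.≟ l | j Fin.≟ l
  ... | yes refl | _ = _ , abtba i≢j , first-∈-abtba u , second-∈-abtba v , first-∈-abtba w
  ... | no _ | yes refl = _ , abtba i≢j , first-∈-abtba u , second-∈-abtba v , second-∈-abtba w
  ... | no i≢l | no j≢l = distinct u v w
    where
    distinct : ∀ {u v w} → Rung i u → Rung j v → Rung l w → Collinear u v w
    distinct rung-a rung-a rung-a = _ , ababa i≢j i≢l j≢l , 1st , 3rd , 5th
    distinct rung-a rung-a rung-b = _ , ababa i≢j i≢l j≢l , 1st , 3rd , 2nd
    distinct rung-b rung-a rung-a = _ , ababa i≢j i≢l j≢l , 4th , 3rd , 5th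
    distinct rung-b rung-a rung-b = _ , ababa i≢j i≢l j≢l , 4th , 3rd , 2nd
    distinct rung-a rung-b rung-a = _ , babab i≢j i≢l j≢l , 4th , 3rd , 2nd
    distinct rung-a rung-b rung-b = _ , babab i≢j i≢l j≢l , 4th , 3rd , 5th
    distinct rung-b rung-b rung-a = _ , babab i≢j i≢l j≢l , 1st , 3rd , 2nd
    distinct rung-b rung-b rung-b = _ , babab i≢j i≢l j≢l , 1st , 3rd , 5th

  aa-collinear : ∀ {i j} → i ≢ j → ∀ w → Collinear (a i) (a j) w
  aa-collinear i≢j (r q) with view q
  ... | ‵fromℕ     = _ , ayabt i≢j , 1st , 3rd , 2nd
  ... | ‵inject₁ q = _ , asab-spine i≢j , 1st , 3rd , there (there (there (there (∈-init q))))
  aa-collinear i≢j s     = _ , asab-spine i≢j , 1st , 3rd , 2nd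
  aa-collinear i≢j t     = _ , ayabt i≢j , 1st , 3rd , 5th
  aa-collinear i≢j (a l) = three-rungs i≢j rung-a rung-a rung-a
  aa-collinear i≢j (b l) = three-rungs i≢j rung-a rung-a rung-b

  bb-collinear : ∀ {i j} → i ≢ j → ∀ w → Collinear (b i) (b j) w
  bb-collinear i≢j (r zero)    = _ , bxbas i≢j , 1st , 3rd , 2nd
  bb-collinear i≢j (r (suc q)) = _ , spine-abtb i≢j , after-tail 4th , after-tail 2nd , ∈-tail q
  bb-collinear i≢j s     = _ , bxbas i≢j , 1st , 3rd , 5th
  bb-collinear i≢j t     = _ , spine-abtb i≢j , after-tail 4th , after-tail 2nd , after-tail 3rd
  bb-collinear i≢j (a l) = three-rungs i≢j rung-b rung-b rung-a
  bb-collinear i≢j (b l) = three-rungs i≢j rung-b rung-b rung-b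

  ab-collinear : ∀ {i j} → i ≢ j → ∀ w → Collinear (a i) (b j) w
  ab-collinear i≢j (r q) with view q
  ... | ‵fromℕ     = _ , spine-abtb i≢j , after-tail 1st , after-tail 2nd , ∈-tail (fromℕ k)
  -- With the indices exchanged, the third and fourth vertices of the path are `a i` and `b j`.
  ... | ‵inject₁ q = _ , asab-spine (i≢j ∘ sym) , 3rd , 4th , there (there (there (there (∈-init q))))
  ab-collinear i≢j s     = _ , asab-spine (i≢j ∘ sym) , 3rd , 4th , 2nd
  ab-collinear i≢j t     = _ , spine-abtb i≢j , after-tail 1st , after-tail 2nd , after-tail 3rd
  ab-collinear i≢j (a l) = three-rungs i≢j rung-a rung-b rung-a
  ab-collinear i≢j (b l) = three-rungs i≢j rung-a rung-b rung-b

  rungs-collinear : ∀ {i j u v} → i ≢ j → Rung i u → Rung j v → ∀ w → Collinear u v w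
  rungs-collinear i≢j rung-a rung-a w = aa-collinear i≢j w
  rungs-collinear i≢j rung-b rung-b w = bb-collinear i≢j w
  rungs-collinear i≢j rung-a rung-b w = ab-collinear i≢j w
  rungs-collinear i≢j rung-b rung-a w = collinear-swap (ab-collinear (i≢j ∘ sym) w)

  -- A vertex outside the rungs lies on the cycle of every index, so the index can be chosen to suit
  -- the other vertices.
  rung? : ∀ v → (∃ λ j → Rung j v) ⊎ (∀ j → OnCycle j v)
  rung? (r i) = inj₂ λ _ → on-r i
  rung? s     = inj₂ λ _ → on-s
  rung? t     = inj₂ λ _ → on-t
  rung? (a j) = inj₁ (j , rung-a)
  rung? (b j) = inj₁ (j , rung-b)

  rung⇒onCycle : ∀ {j v} → Rung j v → OnCycle j v
  rung⇒onCycle rung-a = on-a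
  rung⇒onCycle rung-b = on-b

  onCycle? : ∀ j v → OnCycle j v ⊎ (∃ λ i → j ≢ i × Rung i v)
  onCycle? j v with rung? v
  ... | inj₂ on = inj₁ (on j)
  ... | inj₁ (i , rung) with j Fin.≟ i
  ...   | yes refl = inj₁ (rung⇒onCycle rung)
  ...   | no j≢i   = inj₂ (i , j≢i , rung)

  -- Either all three vertices lie on the cycle of index `j`, or `v` or `w` belongs to a different
  -- rung and the explicit paths apply.
  rung-collinear : ∀ {j u} → Rung j u → ∀ v w → Collinear u v w
  rung-collinear {j} rung v w with onCycle? j v | onCycle? j w
  ... | inj₂ (_ , j≢i , rung′) | _ = rungs-collinear j≢i rung rung′ w
  ... | inj₁ _ | inj₂ (_ , j≢i , rung′) =
    collinear-swap (collinear-rotate (collinear-rotate (rungs-collinear j≢i rung rung′ v)))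
  ... | inj₁ on-v | inj₁ on-w = cycle-collinear (rung⇒onCycle rung) on-v on-w

  all-collinear : ∀ u v w → Collinear u v w
  all-collinear u v w with rung? u | rung? v | rung? w
  ... | inj₁ (_ , rung) | _ | _ = rung-collinear rung v w
  ... | inj₂ _ | inj₁ (_ , rung) | _ = collinear-swap (rung-collinear rung u w)
  ... | inj₂ _ | inj₂ _ | inj₁ (_ , rung) = collinear-rotate (rung-collinear rung u v)
  -- Every cycle contains the three vertices, so any index will do.
  ... | inj₂ on-u | inj₂ on-v | inj₂ on-w = cycle-collinear (on-u zero) (on-v zero) (on-w zero)

  -- Lists `s` at both ends, so there are `7 + k` entries for a cycle of length `6 + k`.
  cycle : Fin m → List V
  cycle j = s ∷ t ∷ b j ∷ spine ++ a j ∷ s ∷ []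

  cycle-walk : ∀ j → Walk Adj s (cycle j) s
  cycle-walk j = step (inj₁ s⟶t) (step (inj₁ t⟶b) (step (inj₁ b⟶r)
    (walk-tabulate Adj inj₁ r~r (step y~a (step (inj₂ s⟶a) stop)))))

  ∈-cycle : ∀ {j v} → OnCycle j v → v List.∈ cycle j
  ∈-cycle (on-r i) = there (there (there (∈-spine i)))
  ∈-cycle on-s     = 1st
  ∈-cycle on-t     = 2nd
  ∈-cycle on-a     = there (there (there (∈-++⁺ʳ spine 1st)))
  ∈-cycle on-b     = 3rd

  length-cycle : ∀ j → length (cycle j) ≡ 7 + k
  length-cycle j = cong (3 +_) (trans (length-++ spine)
    (trans (cong (_+ 2) (length-tabulate {n = 2 + k} inj₁)) (ℕ.+-comm (2 + k) 2)))

  -- The bounds say that `k` is `2e` or `2e + 1`; the cycles then have length `2D` or `2D + 1`, so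
  -- two vertices on a common cycle are at distance at most `D`.
  module Diameter (e : ℕ) (2e≤k : e + e ≤ k) (k≤1+2e : k ≤ suc (e + e)) where

    D : ℕ
    D = 3 + e

    cycle-short : ∀ {j u v} → OnCycle j u → OnCycle j v → ShortWalk Adj (suc D) u v
    cycle-short {j} on-u on-v = closed-walk-short Adj Sum.swap D (cycle-walk j)
      (≤-trans (≤-reflexive (length-cycle j))
        (subst (7 + k ≤_) (double e) (ℕ.+-monoʳ-≤ 7 k≤1+2e)))
      (∈-cycle on-u) (∈-cycle on-v)
      where
      double : ∀ e → 7 + suc (e + e) ≡ 2 + ((3 + e) + (3 + e))
      double = solve-∀

    rungs-short : ∀ {i j u v} → i ≢ j → Rung i u → Rung j v → ShortWalk Adj (suc D) u v
    rungs-short i≢j rung-a rung-a = _ , step (inj₂ s⟶a) (step (inj₁ s⟶a) stop) , s≤s (s≤s (s≤s z≤n))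
    rungs-short i≢j rung-b rung-b = _ , step (inj₂ t⟶b) (step (inj₁ t⟶b) stop) , s≤s (s≤s (s≤s z≤n))
    rungs-short i≢j rung-a rung-b = _ , step (a~b i≢j) stop , s≤s (s≤s z≤n)
    rungs-short i≢j rung-b rung-a = _ , step (b~a i≢j) stop , s≤s (s≤s z≤n)

    short : ∀ u v → ShortWalk Adj (suc D) u v
    short u v with rung? u | rung? v
    ... | inj₂ on-u | inj₂ on-v = cycle-short (on-u zero) (on-v zero)
    ... | inj₂ on-u | inj₁ (j , rung) = cycle-short (on-u j) (rung⇒onCycle rung)
    ... | inj₁ (j , rung) | _ with onCycle? j v
    ...   | inj₁ on-v = cycle-short (rung⇒onCycle rung) on-v
    ...   | inj₂ (_ , j≢i , rung′) = rungs-short j≢i rung rung′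

    -- The two ways from t to `r i`: through some `b j` and x, or through s, some `a j` and y.
    along : ℕ → ℕ
    along i = (2 + i) ⊓ (3 + (suc k ∸ i))

    -- The distance from t.
    f : V → ℕ
    f (r i) = along (toℕ i)
    f s     = 1
    f t     = 0
    f (a _) = 2
    f (b _) = 1

    ∸-step : ∀ p i → p ∸ i ≤ suc (p ∸ suc i)
    ∸-step zero    zero    = z≤n
    ∸-step zero    (suc i) = z≤n
    ∸-step (suc p) zero    = ≤-refl
    ∸-step (suc p) (suc i) = ∸-step p i

    along-up : ∀ i → along (suc i) ≤ suc (along i)
    along-up i = ℕ.⊓-mono-≤ ≤-refl (≤-trans (ℕ.+-monoʳ-≤ 3 (ℕ.∸-monoʳ-≤ (suc k) (ℕ.n≤1+n i))) (ℕ.n≤1+n _))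

    along-down : ∀ i → along i ≤ suc (along (suc i))
    along-down i = ℕ.⊓-mono-≤ (≤-trans (ℕ.n≤1+n _) (ℕ.n≤1+n _)) (ℕ.+-monoʳ-≤ 3 (∸-step (suc k) i))

    lipschitz : ∀ {u v} → Adj u v → f v ≤ suc (f u)
    lipschitz (inj₁ (r⟶r {i} eq)) = subst (λ j → along j ≤ suc (along (toℕ i))) eq (along-up (toℕ i))
    lipschitz (inj₂ (r⟶r {i} eq)) = subst (λ j → along (toℕ i) ≤ suc (along j)) eq (along-down (toℕ i))
    lipschitz (inj₁ (r⟶a {i} eq)) = ≤-trans (ℕ.⊓-glb (s≤s (s≤s z≤n)) (s≤s (s≤s z≤n))) (ℕ.n≤1+n _)
    lipschitz (inj₂ (r⟶a {i} eq)) = ≤-trans (ℕ.m⊓n≤n (2 + toℕ i) _)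
      (≤-reflexive (cong (3 +_) (trans (cong (suc k ∸_) eq) (ℕ.n∸n≡0 (suc k)))))
    lipschitz (inj₁ b⟶r)     = ≤-refl
    lipschitz (inj₂ b⟶r)     = s≤s z≤n
    lipschitz (inj₁ s⟶t)     = z≤n
    lipschitz (inj₂ s⟶t)     = ≤-refl
    lipschitz (inj₁ s⟶a)     = ≤-refl
    lipschitz (inj₂ s⟶a)     = s≤s z≤n
    lipschitz (inj₁ t⟶b)     = ≤-refl
    lipschitz (inj₂ t⟶b)     = z≤n
    lipschitz (inj₁ (a⟶b _)) = s≤s z≤n
    lipschitz (inj₂ (a⟶b _)) = ≤-refl

    e≤k : e ≤ k
    e≤k = ≤-trans (ℕ.m≤m+n e e) 2e≤k

    -- Opposite t on the cycles: the way through x has length `3 + e`, and the way through y has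
    -- length `3 + (k ∸ e)`, which is no shorter because `2e ≤ k`.
    middle : Fin (2 + k)
    middle = fromℕ< {suc e} (s≤s (s≤s e≤k))

    far-middle : D ≤ f (r middle)
    far-middle = subst (λ i → D ≤ along i) (sym (Fin.toℕ-fromℕ< (s≤s (s≤s e≤k))))
      (ℕ.⊓-glb ≤-refl (ℕ.+-monoʳ-≤ 3 (ℕ.m+n≤o⇒m≤o∸n e 2e≤k)))

    realised : ∃ λ (G : Graph ((2 + k) + (2 + (m + m)))) →
               HasMonophonicPositionNumber G 2 × HasDiameter G D
    realised = Realisation.realised Adj Sum.swap irrefl
      (λ u v → (u ⟶? v) ⊎-dec (v ⟶? u))
      ((↔-id _ ⊎-↔ ((↔-id _ ⊎-↔ Fin.+↔⊎) ↔-∘ Fin.+↔⊎)) ↔-∘ Fin.+↔⊎)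
      D (s≤s z≤n) all-collinear short f lipschitz t (r middle) refl far-middle

-- All orders from `2D` on.

Realisable : ℕ → ℕ → Set₁
Realisable n D = ∃ λ (G : Graph n) → HasMonophonicPositionNumber G 2 × HasDiameter G D

parity : ∀ q → ∃ λ h → q ≡ h + h ⊎ q ≡ suc (h + h)
parity zero          = 0 , inj₁ refl
parity (suc zero)    = 0 , inj₂ refl
parity (suc (suc q)) with h , eq ← parity q =
  suc h , Sum.map (λ eq → bump 0 eq) (bump 1) eq
  where
  double : ∀ c h → 2 + (c + (h + h)) ≡ c + (suc h + suc h)
  double = solve-∀
  bump : ∀ c {p h} → p ≡ c + (h + h) → 2 + p ≡ c + (suc h + suc h)
  bump c {h = h} eq = trans (cong (2 +_) eq) (double c h)

-- The subdivided crown has order `k + 2h + 6`. With `D = 3 + e`, the choice `k = 2e` gives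
-- `2D + 2h` and `k = 2e + 1` gives `2D + 2h + 1`, so the parity of `n - 2D` decides.
realisable-half : ∀ n D → 3 ≤ D → D ≤ ⌊ n /2⌋ → Realisable n D
realisable-half n D@(suc (suc (suc e))) (s≤s (s≤s (s≤s _))) D≤n/2
  with h , q≡ ← parity (n ∸ (D + D)) = [ even h , odd h ]′ q≡
  where
  n≡ : (D + D) + (n ∸ (D + D)) ≡ n
  n≡ = ℕ.m+[n∸m]≡n (≤-trans (ℕ.+-mono-≤ D≤n/2 (≤-trans D≤n/2 (ℕ.⌊n/2⌋≤⌈n/2⌉ n)))
                            (≤-reflexive (ℕ.⌊n/2⌋+⌈n/2⌉≡n n)))
  even : ∀ h → n ∸ (D + D) ≡ h + h → Realisable n D
  even h eq = subst (λ n → Realisable n D)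
    (trans (order e h) (trans (cong ((D + D) +_) (sym eq)) n≡))
    (Crown.Diameter.realised (e + e) h e ≤-refl (ℕ.n≤1+n _))
    where
    order : ∀ e h → (2 + (e + e)) + (2 + (suc h + suc h)) ≡ ((3 + e) + (3 + e)) + (h + h)
    order = solve-∀
  odd : ∀ h → n ∸ (D + D) ≡ suc (h + h) → Realisable n D
  odd h eq = subst (λ n → Realisable n D)
    (trans (order e h) (trans (cong ((D + D) +_) (sym eq)) n≡))
    (Crown.Diameter.realised (suc (e + e)) h e (ℕ.n≤1+n _) ≤-refl)
    where
    order : ∀ e h → (3 + (e + e)) + (2 + (suc h + suc h)) ≡ ((3 + e) + (3 + e)) + suc (h + h)
    order = solve-∀


-- Distance layers of a connected graph.

least : {P : ℕ → Set} → Unary.Decidable P → ∀ k → P k → ∃ λ l → P l × (∀ j → P j → l ≤ j)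
least P? zero    p = zero , p , λ _ _ → z≤n
least P? (suc k) p with P? zero
... | yes p₀ = zero , p₀ , λ _ _ → z≤n
... | no ¬p₀ with l , q , minimal ← least (P? ∘ suc) k p =
  suc l , q , λ { zero p₀ → contradiction p₀ ¬p₀ ; (suc j) pj → s≤s (minimal j pj) }

lookup-injective : ∀ {A : Set} {xs : List A} → Unique xs → ∀ {i j} → lookup xs i ≡ lookup xs j → i ≡ j
lookup-injective (_ ∷ _)      {zero}  {zero}  _  = refl
lookup-injective (fresh ∷ _)  {zero}  {suc j} eq = contradiction eq (All.lookup fresh (∈-lookup j))
lookup-injective (fresh ∷ _)  {suc i} {zero}  eq = contradiction (sym eq) (All.lookup fresh (∈-lookup i))
lookup-injective (_ ∷ unique) {suc i} {suc j} eq = cong suc (lookup-injective unique eq)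

module _ {n : ℕ} (G : Graph n) where
  open Graph G using (Adj; adj?; irrefl) renaming (sym to adj-sym)

  -- The distance to `root` as a function, with `descend` giving a neighbour one layer closer. It is
  -- needed for both ends of a diametral pair.
  record Layering (root : Fin n) : Set where
    field
      d           : Fin n → ℕ
      hasDistance : ∀ v → HasDistance G v root (d v)
      lipschitz   : ∀ {v w} → Adj v w → d v ≤ suc (d w)
      descend     : ∀ {v k} → d v ≡ suc k → ∃ λ w → Adj v w × d w ≡ k
      d-root      : d root ≡ 0
      d≡0         : ∀ {v} → d v ≡ 0 → v ≡ root

  distance-unique : ∀ {u v c d} → HasDistance G u v c → HasDistance G u v d → c ≡ d
  distance-unique ((_ , p , refl′) , minimal) ((_ , q , refl″) , minimal′) = ℕ.≤-antisym
    (ℕ.≤-pred (≤-trans (minimal _ q) (≤-reflexive refl″)))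
    (ℕ.≤-pred (≤-trans (minimal′ _ p) (≤-reflexive refl′)))

  module _ (connected : Connected G) (root : Fin n) where

    -- Walks to the root with exactly `k` edges, without their vertex lists. By recursion on `k`
    -- this is decidable over finitely many vertices, so a least `k` can be found.
    Steps : ℕ → Fin n → Set
    Steps zero    v = v ≡ root
    Steps (suc k) v = ∃ λ w → Adj v w × Steps k w

    steps? : ∀ v → Unary.Decidable (λ k → Steps k v)
    steps? v zero    = v Fin.≟ root
    steps? v (suc k) = Fin.any? (λ w → adj? v w ×-dec steps? w k)

    walk⇒steps : ∀ {v xs} → Walk Adj v xs root → ∃ λ k → Steps k v × length xs ≡ suc k
    walk⇒steps stop = 0 , refl , refl
    walk⇒steps (step a p) with k , q , eq ← walk⇒steps p = suc k , (_ , a , q) , cong suc eq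

    steps⇒walk : ∀ k {v} → Steps k v → ∃ λ xs → Walk Adj v xs root × length xs ≡ suc k
    steps⇒walk zero    refl        = _ , stop , refl
    steps⇒walk (suc k) (w , a , q) with xs , p , eq ← steps⇒walk k q = _ , step a p , cong suc eq

    nearest : ∀ v → ∃ λ k → Steps k v × (∀ j → Steps j v → k ≤ j)
    nearest v with xs , path ← connected v root
              with k , q , _ ← walk⇒steps (isPath⇒walk G path)
              = least (steps? v) k q

    layering : Layering root
    layering = record
      { d = d ; hasDistance = hasDistance ; lipschitz = lipschitz ; descend = descend
      ; d-root = ℕ.n≤0⇒n≡0 (d≤ 0 refl) ; d≡0 = λ {v} eq → subst (λ k → Steps k v) eq (reaches v) }
      where
      d : Fin n → ℕ
      d v = proj₁ (nearest v)
      reaches : ∀ v → Steps (d v) v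
      reaches v = proj₁ (proj₂ (nearest v))
      d≤ : ∀ {v} j → Steps j v → d v ≤ j
      d≤ {v} = proj₂ (proj₂ (nearest v))
      lipschitz : ∀ {v w} → Adj v w → d v ≤ suc (d w)
      lipschitz {w = w} a = d≤ _ (w , a , reaches w)
      descend : ∀ {v k} → d v ≡ suc k → ∃ λ w → Adj v w × d w ≡ k
      descend {v} {k} eq with w , a , q ← subst (λ k → Steps k v) eq (reaches v) =
        w , a , ℕ.≤-antisym (d≤ k q) (ℕ.≤-pred (≤-trans (≤-reflexive (sym eq)) (lipschitz a)))
      minimal : ∀ {v} xs → IsPath G v root xs → suc (d v) ≤ length xs
      minimal xs path with k , q , eq ← walk⇒steps (isPath⇒walk G path) =
        ≤-trans (s≤s (d≤ k q)) (≤-reflexive (sym eq))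
      hasDistance : ∀ v → HasDistance G v root (d v)
      hasDistance v with xs , p , eq ← steps⇒walk (d v) (reaches v)
                    with ys , path , ≤xs ← walk⇒path G p
        = (ys , path , ℕ.≤-antisym (≤-trans ≤xs (≤-reflexive eq)) (minimal ys path)) , minimal

  -- Neighbours on a chordless path.

  module _ {xs : List (Fin n)} (chordless : Chordless G xs) where

    neighbour-positions : ∀ {i j} → Adj (lookup xs i) (lookup xs j) →
                          suc (toℕ i) ≡ toℕ j ⊎ suc (toℕ j) ≡ toℕ i
    neighbour-positions {i} {j} a with ℕ.<-cmp (toℕ i) (toℕ j)
    ... | tri≈ _ eq _ = contradiction a (irrefl (cong (lookup xs) (Fin.toℕ-injective eq)))
    ... | tri< i<j _ _ with ℕ.m≤n⇒m<n∨m≡n i<j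
    ...   | inj₁ far = contradiction a (chordless i j far)
    ...   | inj₂ eq  = inj₁ eq
    neighbour-positions {i} {j} a | tri> _ _ j<i with ℕ.m≤n⇒m<n∨m≡n j<i
    ...   | inj₁ far = contradiction (adj-sym a) (chordless j i far)
    ...   | inj₂ eq  = inj₂ eq

    -- Neighbours of `c` occupy positions next to that of `c`, and there are only two of these.
    no-three-neighbours : ∀ {c x y z} → c List.∈ xs → x List.∈ xs → y List.∈ xs → z List.∈ xs →
                          Adj c x → Adj c y → Adj c z → ¬ Distinct₃ x y z
    no-three-neighbours {c} c∈ x∈ y∈ z∈ cx cy cz (x≢y , x≢z , y≢z) =
      [ x≢y ∘ same x∈ y∈ , [ x≢z ∘ same x∈ z∈ , y≢z ∘ same y∈ z∈ ] ]
      (clash (side x∈ cx) (side y∈ cy) (side z∈ cz))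
      where
      Beside : ℕ → ℕ → Set
      Beside p i = suc p ≡ i ⊎ suc i ≡ p
      clash : ∀ {p i j l} → Beside p i → Beside p j → Beside p l → i ≡ j ⊎ i ≡ l ⊎ j ≡ l
      clash (inj₁ i) (inj₁ j) _        = inj₁ (trans (sym i) j)
      clash (inj₂ i) (inj₂ j) _        = inj₁ (ℕ.suc-injective (trans i (sym j)))
      clash (inj₁ i) (inj₂ _) (inj₁ l) = inj₂ (inj₁ (trans (sym i) l))
      clash (inj₂ i) (inj₁ _) (inj₂ l) = inj₂ (inj₁ (ℕ.suc-injective (trans i (sym l))))
      clash (inj₂ _) (inj₁ j) (inj₁ l) = inj₂ (inj₂ (trans (sym j) l))
      clash (inj₁ _) (inj₂ j) (inj₂ l) = inj₂ (inj₂ (ℕ.suc-injective (trans j (sym l))))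
      side : ∀ {x} (x∈ : x List.∈ xs) → Adj c x → Beside (toℕ (Any.index c∈)) (toℕ (Any.index x∈))
      side x∈ a = neighbour-positions (subst₂ Adj (Any.lookup-index c∈) (Any.lookup-index x∈) a)
      same : ∀ {x y} (x∈ : x List.∈ xs) (y∈ : y List.∈ xs) →
             toℕ (Any.index x∈) ≡ toℕ (Any.index y∈) → x ≡ y
      same x∈ y∈ eq = trans (Any.lookup-index x∈)
        (trans (cong (lookup xs) (Fin.toℕ-injective eq)) (sym (Any.lookup-index y∈)))

  -- Layers in a graph of monophonic position number 2.

  module _ (positions≤2 : ∀ S → InMonophonicPosition G S → ∣ S ∣ ≤ 2) where

    -- Three vertices on no common monophonic path would form a set of size 3 in monophonic
    -- position. The doubly negated form avoids a search over paths and suffices for a decidable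
    -- conclusion.
    collinear-triple : ∀ {x y z} → Distinct₃ x y z →
      ¬ (∀ u v xs → IsMonophonicPath G u v xs → ¬ (x List.∈ xs × y List.∈ xs × z List.∈ xs))
    collinear-triple {x} {y} {z} distinct avoided =
      ℕ.<⇒≱ (3≤∣p∣⁺ distinct (x∈p∪q⁺ (inj₁ (x∈⁅x⁆ x)))
                (x∈p∪q⁺ (inj₂ (x∈p∪q⁺ (inj₁ (x∈⁅x⁆ y)))))
                (x∈p∪q⁺ (inj₂ (x∈p∪q⁺ (inj₂ (x∈⁅x⁆ z))))))
            (positions≤2 triple mono)
      where
      triple : Subset n
      triple = ⁅ x ⁆ ∪ (⁅ y ⁆ ∪ ⁅ z ⁆)
      ∈-triple : ∀ {w} → w ∈ triple → w ≡ x ⊎ w ≡ y ⊎ w ≡ z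
      ∈-triple w∈ = Sum.map (x∈⁅y⁆⇒x≡y x) (Sum.map (x∈⁅y⁆⇒x≡y y) (x∈⁅y⁆⇒x≡y z) ∘ x∈p∪q⁻ ⁅ y ⁆ ⁅ z ⁆)
                            (x∈p∪q⁻ ⁅ x ⁆ _ w∈)
      at-most-pair : ∀ {p : Subset n} v w → (∀ {u} → u ∈ p → u ≡ v ⊎ u ≡ w) → ∣ p ∣ ≤ 2
      at-most-pair v w cover = ≤-trans
        (p⊆q⇒∣p∣≤∣q∣ {q = ⁅ v ⁆ ∪ ⁅ w ⁆} λ u∈ → x∈p∪q⁺ (Sum.map (λ { refl → x∈⁅x⁆ v }) (λ { refl → x∈⁅x⁆ w }) (cover u∈)))
        (∣pair∣≤2 v w)
      mono : InMonophonicPosition G triple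
      mono u v xs path with ∈-dec Fin._≟_ x xs | ∈-dec Fin._≟_ y xs | ∈-dec Fin._≟_ z xs
      ... | yes x∈ | yes y∈ | yes z∈ = contradiction (x∈ , y∈ , z∈) (avoided u v xs path)
      ... | no x∉ | _ | _ = at-most-pair y z λ w∈ → drop-x (x∈p∩q⁻ triple _ w∈)
        where
        drop-x : ∀ {w} → w ∈ triple × w ∈ ⋃ (map ⁅_⁆ xs) → w ≡ y ⊎ w ≡ z
        drop-x (w∈ , w∈xs) with ∈-triple w∈
        ... | inj₁ refl = contradiction (∈-⋃⁻ xs w∈xs) x∉
        ... | inj₂ eq   = eq
      ... | yes _ | no y∉ | _ = at-most-pair x z λ w∈ → drop-y (x∈p∩q⁻ triple _ w∈)
        where
        drop-y : ∀ {w} → w ∈ triple × w ∈ ⋃ (map ⁅_⁆ xs) → w ≡ x ⊎ w ≡ z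
        drop-y (w∈ , w∈xs) with ∈-triple w∈
        ... | inj₁ eq          = inj₁ eq
        ... | inj₂ (inj₁ refl) = contradiction (∈-⋃⁻ xs w∈xs) y∉
        ... | inj₂ (inj₂ eq)   = inj₂ eq
      ... | yes _ | yes _ | no z∉ = at-most-pair x y λ w∈ → drop-z (x∈p∩q⁻ triple _ w∈)
        where
        drop-z : ∀ {w} → w ∈ triple × w ∈ ⋃ (map ⁅_⁆ xs) → w ≡ x ⊎ w ≡ y
        drop-z (w∈ , w∈xs) with ∈-triple w∈
        ... | inj₁ eq          = inj₁ eq
        ... | inj₂ (inj₁ eq)   = inj₂ eq
        ... | inj₂ (inj₂ refl) = contradiction (∈-⋃⁻ xs w∈xs) z∉

    module _ {root : Fin n} (L : Layering root) where
      open Layering L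

      -- Allows an empty layer, so layers beyond the last one count as well.
      Thin : ℕ → Set
      Thin i = ∀ x y → d x ≡ i → d y ≡ i → x ≡ y

      -- A discrete intermediate value argument: `d` changes by at most one along an edge and so
      -- cannot jump over `i`.
      one-sided : ∀ {i x xs} → Linked Adj (x ∷ xs) → All (λ z → d z ≢ i) (x ∷ xs) →
                  All (λ z → d z < i) (x ∷ xs) ⊎ All (λ z → i < d z) (x ∷ xs)
      one-sided {i} {x} [-] (≢i ∷ []) with ℕ.<-cmp (d x) i
      ... | tri< <i _ _ = inj₁ (<i ∷ [])
      ... | tri≈ _ ≡i _ = contradiction ≡i ≢i
      ... | tri> _ _ >i = inj₂ (>i ∷ [])
      one-sided (a ∷ linked) (≢i ∷ off) with one-sided linked off
      ... | inj₁ (y<i ∷ below) = inj₁ (ℕ.≤∧≢⇒< (≤-trans (lipschitz a) y<i) ≢i ∷ y<i ∷ below)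
      ... | inj₂ (i<y ∷ above) =
        inj₂ (ℕ.≤∧≢⇒< (ℕ.≤-pred (≤-trans i<y (lipschitz (adj-sym a)))) (≢i ∘ sym) ∷ i<y ∷ above)

      meets-layer : ∀ {i x y} xs → Linked Adj xs → x List.∈ xs → y List.∈ xs →
                    d x < i → i < d y → ¬ All (λ z → d z ≢ i) xs
      meets-layer (_ ∷ _) linked x∈ y∈ x<i i<y off with one-sided linked off
      ... | inj₁ below = ℕ.<-asym i<y (All.lookup below y∈)
      ... | inj₂ above = ℕ.<-asym x<i (All.lookup above x∈)

      -- Two vertices of the next layer and a neighbour c′ in the previous one
      -- are all adjacent to the single vertex c of layer 1 + i. A path through the
      -- three of them visits c, where it would have three neighbours.
      thin-suc : ∀ {i} → Thin (suc i) → Thin (2 + i)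
      thin-suc {i} thin x y dx dy
        with c , xc , dc ← descend dx
        with e , ye , de ← descend dy
        with refl ← thin c e dc de
        with c′ , cc′ , dc′ ← descend dc
        = decidable-stable (x Fin.≟ y) λ x≢y →
          collinear-triple (x≢y , gap dx dc′ , gap dy dc′) λ u v xs (path , chordless) (x∈ , y∈ , c′∈) →
          meets-layer xs (IsPath.linked path) c′∈ x∈
            (≤-reflexive (cong suc dc′)) (≤-reflexive (sym dx))
            (All.tabulate λ z∈ dz → no-three-neighbours chordless
              (subst (List._∈ xs) (thin _ c dz dc) z∈) x∈ y∈ c′∈
              (adj-sym xc) (adj-sym ye) cc′ (x≢y , gap dx dc′ , gap dy dc′))
        where
        gap : ∀ {w z} → d w ≡ 2 + i → d z ≡ i → w ≢ z
        gap dw dz refl = ℕ.<⇒≢ (s≤s (ℕ.n≤1+n i)) (trans (sym dz) dw)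

      -- Induction by `thin-suc`. The starting layer has positive index: the root's layer is always
      -- thin and says nothing about the next one.
      thin-≥ : ∀ {i} → Thin (suc i) → ∀ {j} → i ≤ j → Thin (suc j)
      thin-≥ {i} thin i≤j = subst (λ j → Thin (suc j)) (ℕ.m∸n+n≡m i≤j) (go _)
        where
        go : ∀ j → Thin (suc (j + i))
        go zero    = thin
        go (suc j) = thin-suc (go j)

      -- With thin layers `d` is injective, and it takes values up to `D`.
      all-thin⇒n≤ : ∀ {D} → (∀ i → Thin i) → (∀ v → d v ≤ D) → n ≤ suc D
      all-thin⇒n≤ thin d≤D = Fin.injective⇒≤ {f = λ v → fromℕ< (s≤s (d≤D v))} λ {v} {w} eq →
        thin (d w) v w (Fin.fromℕ<-injective _ _ (s≤s (d≤D v)) (s≤s (d≤D w)) eq) refl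

      Wide : ℕ → Set
      Wide i = ∃₂ λ x y → x ≢ y × d x ≡ i × d y ≡ i

      wide? : Unary.Decidable Wide
      wide? i = Fin.any? λ x → Fin.any? λ y →
        ¬? (x Fin.≟ y) ×-dec (d x ℕ.≟ i) ×-dec (d y ℕ.≟ i)

      ¬wide⇒thin : ∀ {i} → ¬ Wide i → Thin i
      ¬wide⇒thin ¬wide x y dx dy =
        decidable-stable (x Fin.≟ y) λ x≢y → ¬wide (x , y , x≢y , dx , dy)

      -- Two rows of `suc D` vertices: each takes one of two distinct vertices from every layer from
      -- 1 to `D`, and the rows are completed by the root and by `u`.
      all-wide⇒≤n : ∀ {D u} → d u ≡ suc D → (∀ (i : Fin D) → Wide (suc (toℕ i))) → suc D + suc D ≤ n
      all-wide⇒≤n {D} {u} du wide =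
        Fin.injective⇒≤ {f = pick ∘ Fin.splitAt (suc D)} λ {i} {j} eq →
          trans (sym (Fin.join-splitAt (suc D) (suc D) i))
            (trans (cong (Fin.join (suc D) (suc D)) (pick-injective (Fin.splitAt (suc D) i) (Fin.splitAt (suc D) j) eq))
                   (Fin.join-splitAt (suc D) (suc D) j))
        where
        pick : Fin (suc D) ⊎ Fin (suc D) → Fin n
        pick (inj₁ zero)    = root
        pick (inj₁ (suc i)) = proj₁ (wide i)
        pick (inj₂ zero)    = u
        pick (inj₂ (suc i)) = proj₁ (proj₂ (wide i))
        layer : Fin (suc D) ⊎ Fin (suc D) → ℕ
        layer (inj₁ i)       = toℕ i
        layer (inj₂ zero)    = suc D
        layer (inj₂ (suc i)) = suc (toℕ i)
        d-pick : ∀ p → d (pick p) ≡ layer p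
        d-pick (inj₁ zero)    = d-root
        d-pick (inj₁ (suc i)) = proj₁ (proj₂ (proj₂ (proj₂ (wide i))))
        d-pick (inj₂ zero)    = du
        d-pick (inj₂ (suc i)) = proj₂ (proj₂ (proj₂ (proj₂ (wide i))))
        inner≢D : ∀ {i : Fin D} → suc (toℕ i) ≢ suc D
        inner≢D {i} eq = ℕ.<⇒≢ (Fin.toℕ<n i) (ℕ.suc-injective eq)
        inner-injective : ∀ {i j : Fin D} → suc (toℕ i) ≡ suc (toℕ j) → i ≡ j
        inner-injective eq = Fin.toℕ-injective (ℕ.suc-injective eq)
        same-layer : ∀ p q → layer p ≡ layer q → pick p ≡ pick q → p ≡ q
        same-layer (inj₁ i)       (inj₁ j)       eq _ = cong inj₁ (Fin.toℕ-injective eq)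
        same-layer (inj₂ zero)    (inj₂ zero)    _  _ = refl
        same-layer (inj₂ (suc i)) (inj₂ (suc j)) eq _ = cong (inj₂ ∘ suc) (inner-injective eq)
        same-layer (inj₂ zero)    (inj₂ (suc j)) eq _ = contradiction (sym eq) inner≢D
        same-layer (inj₂ (suc i)) (inj₂ zero)    eq _ = contradiction eq inner≢D
        same-layer (inj₁ (suc i)) (inj₂ zero)    eq _ = contradiction eq inner≢D
        same-layer (inj₂ zero)    (inj₁ (suc j)) eq _ = contradiction (sym eq) inner≢D
        same-layer (inj₁ (suc i)) (inj₂ (suc j)) eq pick-eq with refl ← inner-injective eq =
          contradiction pick-eq (proj₁ (proj₂ (proj₂ (wide i))))
        same-layer (inj₂ (suc i)) (inj₁ (suc j)) eq pick-eq with refl ← inner-injective eq =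
          contradiction (sym pick-eq) (proj₁ (proj₂ (proj₂ (wide i))))
        pick-injective : ∀ p q → pick p ≡ pick q → p ≡ q
        pick-injective p q eq =
          same-layer p q (trans (sym (d-pick p)) (trans (cong d eq) (d-pick q))) eq

    diameter-dichotomy : ∀ D → HasDiameter G (2 + D) → 2 + D ≡ n ∸ 1 ⊎ (2 + D) + (2 + D) ≤ n
    diameter-dichotomy D (connected , (u , w , distance) , bounded)
      -- The indices `suc (toℕ i)` are those of the layers strictly between `w` and `u`.
      with Fin.any? (λ (i : Fin (suc D)) → ¬? (wide? (layering connected w) (suc (toℕ i))))
    ... | no none = inj₂ (all-wide⇒≤n L (distance-unique (hasDistance u) distance)
      (λ i → decidable-stable (wide? L (suc (toℕ i))) λ ¬wide → none (i , ¬wide)))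
      where
      L = layering connected w
      open Layering L
    ... | yes (i , ¬wide) = inj₁ (cong (_∸ 1) (ℕ.≤-antisym n≥ n≤))
      where
      L  = layering connected w
      L′ = layering connected u
      open Layering L
      open Layering L′ using () renaming (d to d′; descend to descend′; d≡0 to d′≡0; hasDistance to hasDistance′)
      du : d u ≡ 2 + D
      du = distance-unique (hasDistance u) distance
      thin : ∀ {j} → D ≤ j → Thin L (suc j)
      thin D≤j = thin-≥ L (¬wide⇒thin L ¬wide) (≤-trans (ℕ.≤-pred (Fin.toℕ<n i)) D≤j)
      -- A neighbour of `u` lies neither beyond the layer of `u`, by the diameter, nor in it, where
      -- `u` is alone.
      d-near-u : ∀ z → d′ z ≡ 1 → d z ≡ suc D
      d-near-u z d′z with u′ , zu , d′u ← descend′ d′z with refl ← d′≡0 d′u =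
        ℕ.≤-antisym
          (ℕ.≤-pred (ℕ.≤∧≢⇒< (bounded z w (d z) (hasDistance z))
            λ dz → irrefl (thin (ℕ.n≤1+n D) z u dz du) zu))
          (ℕ.≤-pred (≤-trans (≤-reflexive (sym du)) (lipschitz (adj-sym zu))))
      thin′ : ∀ j → Thin L′ j
      thin′ zero    x y d′x d′y = trans (d′≡0 d′x) (sym (d′≡0 d′y))
      -- All neighbours of `u` lie in one thin layer around `w`, so the first layer around `u` is
      -- thin, and thinness spreads from there.
      thin′ (suc j) = thin-≥ L′
        (λ x y d′x d′y → thin ≤-refl x y (d-near-u x d′x) (d-near-u y d′y)) z≤n
      n≤ : n ≤ 3 + D
      n≤ = all-thin⇒n≤ L′ thin′ λ v → bounded v u (d′ v) (hasDistance′ v)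
      -- A shortest path between `u` and `w` already has `3 + D` distinct vertices.
      n≥ : 3 + D ≤ n
      n≥ = let (_ , path , len) , _ = distance in
        subst (_≤ n) len (Fin.injective⇒≤ (lookup-injective (IsPath.unique path)))

theorem4p2 : ∀ (n D : ℕ) → 1 ≤ n → 3 ≤ D →
    (∃ λ (G : Graph n) → HasMonophonicPositionNumber G 2 × HasDiameter G D)
    ⇔ (D ≡ n ∸ 1 ⊎ (3 ≤ D × D ≤ ⌊ n /2⌋))
theorem4p2 n D 1≤n 3≤D = mk⇔ (necessary n D 3≤D) (sufficient n D 1≤n 3≤D)
  where
  necessary : ∀ n D → 3 ≤ D → Realisable n D → D ≡ n ∸ 1 ⊎ (3 ≤ D × D ≤ ⌊ n /2⌋)
  necessary n (suc zero) (s≤s ())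
  necessary n (suc (suc D)) 3≤D (G , (_ , positions≤2) , diameter) =
    Sum.map id (λ 2D≤n → 3≤D , subst (_≤ ⌊ n /2⌋) (⌊m+m/2⌋≡m (2 + D)) (ℕ.⌊n/2⌋-mono 2D≤n))
      (diameter-dichotomy G positions≤2 D diameter)
    where
    ⌊m+m/2⌋≡m : ∀ m → ⌊ m + m /2⌋ ≡ m
    ⌊m+m/2⌋≡m m = sym (ℕ.n≡⌊n+n/2⌋ m)
  sufficient : ∀ n D → 1 ≤ n → 3 ≤ D → D ≡ n ∸ 1 ⊎ (3 ≤ D × D ≤ ⌊ n /2⌋) → Realisable n D
  sufficient (suc n) D _ 3≤D (inj₁ refl)        = PathGraph.realised D (≤-trans (s≤s z≤n) 3≤D)
  sufficient n       D _ 3≤D (inj₂ (_ , D≤n/2)) = realisable-half n D 3≤D D≤n/2
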